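{- Let $m\ge 1$ be an integer and let $E: a_1x_1+\dots+a_{2m+1}x_{2m+1}=0$ be a linear equation with coefficients $a_i\in\mathbb{Z}\setminus\{0\}$ for each $i=1,\dots,2m+1$. Then $E$ is $r$-uncommon over the integers for every integer $r\ge 3$.
   Context: Write $[n]=\{1,\dots,n\}$. Let $E: a_1x_1+\dots+a_kx_k=0$ be a linear equation with nonzero integer coefficients, and let $r\ge 2$ be an integer. An $r$-coloring of $[n]$ is a map $c:[n]\to\{1,\dots,r\}$; a solution $(x_1,\dots,x_k)\in[n]^k$ of $E$ is monochromatic if $c(x_1)=\dots=c(x_k)$. The equation $E$ is $r$-common over the integers if any $r$-coloring of $[n]$ has at least as many monochromatic solutions asymptotically (as $n\to\infty$) as a uniformly random $r$-coloring; that is, the minimum over all $r$-colorings of $[n]$ of the proportion of solutions of $E$ in $[n]^k$ that are monochromatic is at least $r^{1-k}-o(1)$ as $n\to\infty$. Otherwise $E$ is $r$-uncommon over the integers. -}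

module Defs where

open import Data.Nat using (ℕ; zero; suc; _^_; _≥_)
open import Data.Integer as ℤ using (ℤ; 0ℤ; +_)
open import Data.Rational as ℚ using (ℚ; 0ℚ)
open import Data.Fin using (Fin; toℕ)
import Data.Fin.Properties as Fin
open import Data.List as List using (List; length; filter; allFin; cartesianProductWith)
open import Data.Vec using (Vec; []; _∷_; lookup; zipWith; foldr′)
open import Data.Product using (∃)
open import Relation.Binary.PropositionalEquality using (_≡_)
open import Relation.Nullary using (¬_; Dec)
open import Relation.Nullary.Decidable using (_×-dec_)

-- Throughout, [n] = {1,…,n} is represented by Fin n, where i stands for the
-- integer 1 + toℕ i.
⟦_⟧ : ∀ {n} → Fin n → ℤ
⟦ i ⟧ = + suc (toℕ i)

Colouring : (r n : ℕ) → Set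
Colouring r n = Fin n → Fin r

lhs : ∀ {k n} → Vec ℤ k → Vec (Fin n) k → ℤ
lhs a x = foldr′ ℤ._+_ 0ℤ (zipWith (λ aᵢ xᵢ → aᵢ ℤ.* ⟦ xᵢ ⟧) a x)

Solution : ∀ {k n} → Vec ℤ k → Vec (Fin n) k → Set
Solution a x = lhs a x ≡ 0ℤ

Monochromatic : ∀ {k r n} → Colouring r n → Vec (Fin n) k → Set
Monochromatic c x = ∀ i j → c (lookup x i) ≡ c (lookup x j)

solution? : ∀ {k n} (a : Vec ℤ k) (x : Vec (Fin n) k) → Dec (Solution a x)
solution? a x = lhs a x ℤ.≟ 0ℤ

monochromatic? : ∀ {k r n} (c : Colouring r n) (x : Vec (Fin n) k) → Dec (Monochromatic c x)
monochromatic? c x =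
  Fin.all? λ i → Fin.all? λ j → c (lookup x i) Fin.≟ c (lookup x j)

-- Every element of [n]^k, listed exactly once.
tuples : ∀ k n → List (Vec (Fin n) k)
tuples zero    n = [] List.∷ List.[]
tuples (suc k) n = cartesianProductWith _∷_ (allFin n) (tuples k n)

#solutions : ∀ {k} → Vec ℤ k → ℕ → ℕ
#solutions {k} a n = length (filter (solution? a) (tuples k n))

#monochromatic : ∀ {k r n} → Vec ℤ k → Colouring r n → ℕ
#monochromatic {k} {n = n} a c =
  length (filter (λ x → solution? a x ×-dec monochromatic? c x) (tuples k n))

-- The quotient p / q, with the convention p / 0 = 0.
ratio : ℕ → ℕ → ℚ
ratio p zero    = 0ℚ
ratio p (suc q) = + p ℚ./ suc q

-- The convention for ratio matters only when the equation has no solution in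
-- [n]^k.  With nonzero coefficients this happens for large n only if they all
-- have the same sign; the proportion is then 0 for every n.
proportion : ∀ {k r n} → Vec ℤ k → Colouring r n → ℚ
proportion {n = n} a c = ratio (#monochromatic a c) (#solutions a n)

-- "min over c of the proportion is at least r^(1-k) - o(1)": the minimum over
-- the finitely many colourings is unfolded to a quantifier over c, the o(1) to
-- ε and N, and r^(1-k) is written r / r^k.
Common : ∀ {k} → ℕ → Vec ℤ k → Set
Common {k} r a =
  ∀ (ε : ℚ) → 0ℚ ℚ.< ε →
  ∃ λ (N : ℕ) → ∀ (n : ℕ) → n ≥ N → (c : Colouring r n) →
  ratio r (r ^ k) ℚ.- ε ℚ.≤ proportion a c

Uncommon : ∀ {k} → ℕ → Vec ℤ k → Set
Uncommon r a = ¬ Common r a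

{-# OPTIONS --safe #-}

-- Put k = 2m + 1 and let p = 1 + ∏ ∣aᵢ∣, which is coprime to every aᵢ.  The function
-- g x = p [p ∣ x] − 1 has mean zero modulo p, and since any k − 1 coordinates of a solution
-- modulo p are free, the average over all solutions modulo p of ∏ᵢ (B + λ g(xᵢ)) has no
-- mixed terms: it is Bᵏ + λᵏ (p − 1).  Colour x with colour j with probability
-- proportional to B + λⱼ g(x), where λ = (1, 1, −2, 0, …, 0).  As k ≥ 3 is odd,
-- Σⱼ λⱼᵏ = 2 − 2ᵏ < 0, so fewer solutions are expected to be monochromatic than for the
-- uniform colouring.
--
-- Solutions in [n]ᵏ are equidistributed modulo p up to O(n^(k-2)): shifting by a vector in
-- the kernel of a changes only those near the boundary of the box.  Those with
-- a repeated coordinate, where the colours are not independent, are also O(n^(k-2)).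
-- If the equation were r-common, it would have some positive solution, hence of order
-- n^(k-1) solutions for infinitely many n, which dominates these errors.
module Submission where

import Algebra.Properties.Semiring.Sum
open import Data.Fin as Fin using (Fin; zero; suc; toℕ; fromℕ<)
import Data.Fin.Properties as Fin
open import Data.Integer as ℤ using (ℤ; 0ℤ; 1ℤ; +_; -[1+_]; ∣_∣)
import Data.Integer.Properties as ℤ
open import Data.Integer.DivMod using (_%ℕ_; _/ℕ_; n%ℕd<d; a≡a%ℕn+[a/ℕn]*n)
import Data.Integer.Tactic.RingSolver as ℤSolver
open import Data.Integer.Divisibility.Signed
open import Data.List as List using (List; length; filter; cartesianProductWith)
import Data.List.Properties as List
open import Data.Nat as ℕ using (ℕ; zero; suc; _+_; _*_; _^_; _≤_; _<_; _≥_; z≤n; s≤s; NonZero)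
open import Data.Nat.ListAction using () renaming (sum to sumᴸ)
import Data.Nat.Divisibility as ℕ
import Data.Nat.Properties as ℕ
import Data.Nat.Tactic.RingSolver as ℕSolver
open import Data.Product using (∃; _×_; _,_; proj₁; proj₂)
open import Data.Rational as ℚ using (0ℚ; toℚᵘ)
import Data.Rational.Properties as ℚ
open import Data.Rational.Unnormalised as ℚᵘ using (mkℚᵘ)
import Data.Rational.Unnormalised.Properties as ℚᵘ
open import Data.Vec as Vec using (Vec; []; _∷_; lookup; _[_]≔_)
open import Data.Vec.Properties using (lookup∘update; lookup∘update′; lookup-map; lookup∘tabulate)
import Data.Vec.Relation.Unary.All.Properties as All
open import Data.Vec.Relation.Unary.All as All using (All; []; _∷_)
open import Function using (_∘_)
open import Relation.Binary.PropositionalEquality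
open import Relation.Nullary using (¬_; Dec; yes; no; contradiction)
open import Relation.Nullary.Decidable using (_×-dec_)
open import Defs

open import Algebra.Properties.Semiring.Sum ℕ.+-*-semiring
  using (sum; sum-syntax; sum-cong-≗; sum-remove; ∑-distrib-+; ∑-comm; *-distribˡ-sum; *-distribʳ-sum)
module Σℤ = Algebra.Properties.Semiring.Sum ℤ.+-*-semiring

-- Finite sums

-- This construction needs three colours: the weights of the colours at a point must have a constant
-- sum, so the amplitudes λ sum to zero; two amplitudes would be opposite and their odd powers would
-- cancel.
--
-- Counts stay in the natural numbers. Weights are not divided by their sum `L`, so expectations of
-- monochromatic counts appear multiplied by Lᵏ, and a bound K - 1 is written with the 1 on the
-- other side. In these units the gain over the uniform colouring is at least 1 per solution, and
-- only this much of (2ᵏ - 2)(p - 1) is kept.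
--
-- The number of solutions is never computed asymptotically: a sum over the solutions in the box is
-- only compared with its translates by integer kernel vectors. The random colouring is replaced by
-- conditional expectations, available because the expected count over solutions with distinct
-- coordinates is affine in the colour distribution at each point.

∑-mono : ∀ {n} {f g : Fin n → ℕ} → (∀ i → f i ≤ g i) → sum f ≤ sum g
∑-mono {zero}  f≤g = z≤n
∑-mono {suc n} f≤g = ℕ.+-mono-≤ (f≤g zero) (∑-mono (f≤g ∘ suc))

∑-const : ∀ n c → ∑[ i < n ] c ≡ n * c
∑-const zero    c = refl
∑-const (suc n) c = cong (_+_ c) (∑-const n c)

∑-zero : ∀ {n} {f : Fin n → ℕ} → (∀ i → f i ≡ 0) → sum f ≡ 0
∑-zero {n} f≡0 = trans (sum-cong-≗ f≡0) (trans (∑-const n 0) (ℕ.*-zeroʳ n))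

term≤∑ : ∀ {n} (f : Fin n → ℕ) i → f i ≤ sum f
term≤∑ f zero    = ℕ.m≤m+n _ _
term≤∑ f (suc i) = ℕ.≤-trans (term≤∑ (f ∘ suc) i) (ℕ.m≤n+m _ _)

-- Mainly for the way a nonzero coefficient enters: once the other coordinates are fixed, at most
-- one value of its coordinate solves the equation, so summing over that coordinate costs no factor
-- `n`.
∑-support≤1 : ∀ {n} (f : Fin n → ℕ) {M} → (∀ i → f i ≤ M) →
              (∀ i j → f i ≢ 0 → f j ≢ 0 → i ≡ j) → sum f ≤ M
∑-support≤1 {zero}  f f≤M uniq = z≤n
∑-support≤1 {suc n} f f≤M uniq with f zero ℕ.≟ 0
... | yes f₀≡0 rewrite f₀≡0 =
  ∑-support≤1 (f ∘ suc) (f≤M ∘ suc) λ i j p q → Fin.suc-injective (uniq _ _ p q)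
... | no f₀≢0 = subst (_≤ _) (sym (trans (cong (_+_ (f zero)) (∑-zero rest≡0)) (ℕ.+-identityʳ _))) (f≤M zero)
  where
  rest≡0 : ∀ i → f (suc i) ≡ 0
  rest≡0 i with f (suc i) ℕ.≟ 0
  ... | yes fᵢ≡0 = fᵢ≡0
  ... | no  fᵢ≢0 with () ← uniq zero (suc i) f₀≢0 fᵢ≢0

∑-injection : ∀ {m n} (e : Fin m → Fin n) → (∀ i j → e i ≡ e j → i ≡ j) →
              ∀ (f : Fin n → ℕ) → ∑[ i < m ] f (e i) ≤ sum f
∑-injection {zero}  e inj f = z≤n
∑-injection {suc m} {zero}  e inj f with () ← e zero
∑-injection {suc m} {suc n} e inj f = begin
  f (e zero) + ∑[ i < m ] f (e (suc i))               ≡⟨ cong (_+_ (f (e zero))) (sum-cong-≗ λ i → cong f (sym (Fin.punchIn-punchOut (e₀≢ i)))) ⟩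
  f (e zero) + ∑[ i < m ] f (Fin.punchIn (e zero) (e′ i))
    ≤⟨ ℕ.+-monoʳ-≤ (f (e zero)) (∑-injection e′ e′-inj (f ∘ Fin.punchIn (e zero))) ⟩
  f (e zero) + ∑[ i < n ] f (Fin.punchIn (e zero) i)  ≡⟨ sym (sum-remove {i = e zero} f) ⟩
  sum f                                               ∎
  where
  open ℕ.≤-Reasoning
  e₀≢ : ∀ i → e zero ≢ e (suc i)
  e₀≢ i eq with () ← inj zero (suc i) eq
  e′ : Fin m → Fin n
  e′ i = Fin.punchOut (e₀≢ i)
  e′-inj : ∀ i j → e′ i ≡ e′ j → i ≡ j
  e′-inj i j eq = Fin.suc-injective (inj _ _ (Fin.punchOut-injective (e₀≢ i) (e₀≢ j) eq))

pos-sum : ∀ {n} (f : Fin n → ℕ) → + sum f ≡ Σℤ.sum (λ i → + f i)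
pos-sum {zero}  f = refl
pos-sum {suc n} f = trans (ℤ.pos-+ (f zero) _) (cong (ℤ._+_ (+ f zero)) (pos-sum (f ∘ suc)))

-- Iterated, so that one coordinate can be summed first or exchanged with another sum;
-- `length-filter-tuples` links it to the counts in the statement.
∑ⱽ : ∀ n k → (Vec (Fin n) k → ℕ) → ℕ
∑ⱽ n zero    F = F []
∑ⱽ n (suc k) F = ∑[ i < n ] ∑ⱽ n k (λ x → F (i ∷ x))

∑ⱽ-cong : ∀ n k {F G : Vec (Fin n) k → ℕ} → (∀ x → F x ≡ G x) → ∑ⱽ n k F ≡ ∑ⱽ n k G
∑ⱽ-cong n zero    eq = eq []
∑ⱽ-cong n (suc k) eq = sum-cong-≗ λ i → ∑ⱽ-cong n k λ x → eq (i ∷ x)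

∑ⱽ-mono : ∀ n k {F G : Vec (Fin n) k → ℕ} → (∀ x → F x ≤ G x) → ∑ⱽ n k F ≤ ∑ⱽ n k G
∑ⱽ-mono n zero    F≤G = F≤G []
∑ⱽ-mono n (suc k) F≤G = ∑-mono λ i → ∑ⱽ-mono n k λ x → F≤G (i ∷ x)

∑ⱽ-const : ∀ n k c → ∑ⱽ n k (λ _ → c) ≡ n ^ k * c
∑ⱽ-const n zero    c = sym (ℕ.+-identityʳ c)
∑ⱽ-const n (suc k) c = begin
  ∑[ i < n ] ∑ⱽ n k (λ _ → c)  ≡⟨ sum-cong-≗ (λ (i : Fin n) → ∑ⱽ-const n k c) ⟩
  ∑[ i < n ] (n ^ k * c)       ≡⟨ ∑-const n _ ⟩
  n * (n ^ k * c)              ≡⟨ sym (ℕ.*-assoc n (n ^ k) c) ⟩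
  n ^ suc k * c                ∎
  where open ≡-Reasoning

∑ⱽ-distrib-+ : ∀ n k (F G : Vec (Fin n) k → ℕ) →
               ∑ⱽ n k (λ x → F x + G x) ≡ ∑ⱽ n k F + ∑ⱽ n k G
∑ⱽ-distrib-+ n zero    F G = refl
∑ⱽ-distrib-+ n (suc k) F G =
  trans (sum-cong-≗ λ i → ∑ⱽ-distrib-+ n k (λ x → F (i ∷ x)) (λ x → G (i ∷ x))) 
    (∑-distrib-+ (λ i → ∑ⱽ n k (λ x → F (i ∷ x))) (λ i → ∑ⱽ n k (λ x → G (i ∷ x))))

*-distribˡ-∑ⱽ : ∀ n k c (F : Vec (Fin n) k → ℕ) → c * ∑ⱽ n k F ≡ ∑ⱽ n k (λ x → c * F x)
*-distribˡ-∑ⱽ n zero    c F = refl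
*-distribˡ-∑ⱽ n (suc k) c F = trans (*-distribˡ-sum c (λ i → ∑ⱽ n k (λ x → F (i ∷ x))))
  (sum-cong-≗ λ i → *-distribˡ-∑ⱽ n k c (λ x → F (i ∷ x)))

∑-∑ⱽ-comm : ∀ m n k (F : Fin m → Vec (Fin n) k → ℕ) →
            ∑[ i < m ] ∑ⱽ n k (F i) ≡ ∑ⱽ n k (λ x → ∑[ i < m ] F i x)
∑-∑ⱽ-comm m n zero    F = refl
∑-∑ⱽ-comm m n (suc k) F = trans (∑-comm (λ i j → ∑ⱽ n k (λ x → F i (j ∷ x))))
  (sum-cong-≗ λ j → ∑-∑ⱽ-comm m n k (λ i x → F i (j ∷ x)))

∑ⱽ-comm : ∀ m l n k (F : Vec (Fin m) l → Vec (Fin n) k → ℕ) →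
          ∑ⱽ m l (λ y → ∑ⱽ n k (F y)) ≡ ∑ⱽ n k (λ x → ∑ⱽ m l (λ y → F y x))
∑ⱽ-comm m zero    n k F = refl
∑ⱽ-comm m (suc l) n k F = trans (sum-cong-≗ λ i → ∑ⱽ-comm m l n k (λ y → F (i ∷ y)))
  (∑-∑ⱽ-comm m n k (λ i x → ∑ⱽ m l (λ y → F (i ∷ y) x)))

∑≢0⇒∃ : ∀ {n} (f : Fin n → ℕ) → sum f ≢ 0 → ∃ λ i → f i ≢ 0
∑≢0⇒∃ {zero}  f ≢0 = contradiction refl ≢0
∑≢0⇒∃ {suc n} f ≢0 with f zero ℕ.≟ 0
... | no  f₀≢0 = zero , f₀≢0
... | yes f₀≡0 with i , fᵢ≢0 ← ∑≢0⇒∃ (f ∘ suc) (λ eq → ≢0 (cong₂ _+_ f₀≡0 eq)) = suc i , fᵢ≢0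

∑ⱽ≢0⇒∃ : ∀ n k (F : Vec (Fin n) k → ℕ) → ∑ⱽ n k F ≢ 0 → ∃ λ x → F x ≢ 0
∑ⱽ≢0⇒∃ n zero    F ≢0 = [] , ≢0
∑ⱽ≢0⇒∃ n (suc k) F ≢0 with i , ≢0′ ← ∑≢0⇒∃ (λ i → ∑ⱽ n k (λ x → F (i ∷ x))) ≢0
  with x , Fx≢0 ← ∑ⱽ≢0⇒∃ n k (λ x → F (i ∷ x)) ≢0′ = i ∷ x , Fx≢0

-- Indicators, and counts of tuples as sums

ind : ∀ {A : Set} → Dec A → ℕ
ind (yes _) = 1
ind (no _)  = 0

ind≤1 : ∀ {A : Set} (A? : Dec A) → ind A? ≤ 1
ind≤1 (yes _) = ℕ.≤-refl
ind≤1 (no _)  = z≤n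

ind-true : ∀ {A : Set} (A? : Dec A) → A → ind A? ≡ 1
ind-true (yes _) _ = refl
ind-true (no ¬a) a = contradiction a ¬a

ind-false : ∀ {A : Set} (A? : Dec A) → ¬ A → ind A? ≡ 0
ind-false (yes a) ¬a = contradiction a ¬a
ind-false (no _)  _  = refl

ind-⇔ : ∀ {A B : Set} (A? : Dec A) (B? : Dec B) → (A → B) → (B → A) → ind A? ≡ ind B?
ind-⇔ (yes a) B? f g = sym (ind-true B? (f a))
ind-⇔ (no ¬a) B? f g = sym (ind-false B? (¬a ∘ g))

ind≢0 : ∀ {A : Set} (A? : Dec A) → ind A? ≢ 0 → A
ind≢0 (yes a) _ = a
ind≢0 (no _)  ≢0 = contradiction refl ≢0

∑ᴸ : ∀ {A : Set} → (A → ℕ) → List A → ℕ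
∑ᴸ f xs = sumᴸ (List.map f xs)

∑ᴸ-++ : ∀ {A : Set} (f : A → ℕ) xs ys → ∑ᴸ f (xs List.++ ys) ≡ ∑ᴸ f xs + ∑ᴸ f ys
∑ᴸ-++ f List.[]       ys = refl
∑ᴸ-++ f (x List.∷ xs) ys = trans (cong (_+_ (f x)) (∑ᴸ-++ f xs ys)) (sym (ℕ.+-assoc (f x) _ _))

∑ᴸ-map : ∀ {A B : Set} (f : B → ℕ) (g : A → B) xs → ∑ᴸ f (List.map g xs) ≡ ∑ᴸ (f ∘ g) xs
∑ᴸ-map f g xs = cong sumᴸ (sym (List.map-∘ xs))

∑ᴸ-cartesianProductWith : ∀ {A B C : Set} (f : C → ℕ) (g : A → B → C) xs ys →
  ∑ᴸ f (cartesianProductWith g xs ys) ≡ ∑ᴸ (λ x → ∑ᴸ (λ y → f (g x y)) ys) xs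
∑ᴸ-cartesianProductWith f g List.[]       ys = refl
∑ᴸ-cartesianProductWith f g (x List.∷ xs) ys =
  trans (∑ᴸ-++ f (List.map (g x) ys) _)
        (cong₂ _+_ (∑ᴸ-map f (g x) ys) (∑ᴸ-cartesianProductWith f g xs ys))

∑ᴸ-tabulate : ∀ {A : Set} {n} (f : A → ℕ) (g : Fin n → A) → ∑ᴸ f (List.tabulate g) ≡ ∑[ i < n ] f (g i)
∑ᴸ-tabulate {n = zero}  f g = refl
∑ᴸ-tabulate {n = suc n} f g = cong (_+_ (f (g zero))) (∑ᴸ-tabulate f (g ∘ suc))

∑ᴸ-tuples : ∀ k n (F : Vec (Fin n) k → ℕ) → ∑ᴸ F (tuples k n) ≡ ∑ⱽ n k F
∑ᴸ-tuples zero    n F = ℕ.+-identityʳ _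
∑ᴸ-tuples (suc k) n F = begin
  ∑ᴸ F (tuples (suc k) n)                                        ≡⟨ ∑ᴸ-cartesianProductWith F _∷_ (List.allFin n) (tuples k n) ⟩
  ∑ᴸ (λ i → ∑ᴸ (λ x → F (i ∷ x)) (tuples k n)) (List.allFin n)   ≡⟨ ∑ᴸ-tabulate (λ i → ∑ᴸ (λ x → F (i ∷ x)) (tuples k n)) (λ i → i) ⟩
  ∑[ i < n ] ∑ᴸ (λ x → F (i ∷ x)) (tuples k n)                   ≡⟨ sum-cong-≗ (λ i → ∑ᴸ-tuples k n (λ x → F (i ∷ x))) ⟩
  ∑ⱽ n (suc k) F                                                 ∎
  where open ≡-Reasoning

length-filter : ∀ {A : Set} {P : A → Set} (P? : ∀ x → Dec (P x)) xs →
                length (filter P? xs) ≡ ∑ᴸ (λ x → ind (P? x)) xs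
length-filter P? List.[] = refl
length-filter P? (x List.∷ xs) with P? x
... | yes _ = cong suc (length-filter P? xs)
... | no  _ = length-filter P? xs

length-filter-tuples : ∀ k n {P : Vec (Fin n) k → Set} (P? : ∀ x → Dec (P x)) →
                       length (filter P? (tuples k n)) ≡ ∑ⱽ n k (λ x → ind (P? x))
length-filter-tuples k n P? = trans (length-filter P? (tuples k n)) (∑ᴸ-tuples k n _)

-- Solutions in a box

dot : ∀ {k} → Vec ℤ k → Vec ℤ k → ℤ
dot []       []       = 0ℤ
dot (a ∷ as) (x ∷ xs) = a ℤ.* x ℤ.+ dot as xs

lhs≡dot : ∀ {k n} (a : Vec ℤ k) (x : Vec (Fin n) k) → lhs a x ≡ dot a (Vec.map ⟦_⟧ x)
lhs≡dot []       []       = refl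
lhs≡dot (a ∷ as) (x ∷ xs) = cong (ℤ._+_ (a ℤ.* ⟦ x ⟧)) (lhs≡dot as xs)

infixl 6 _⊕_
_⊕_ : ∀ {k} → Vec ℤ k → Vec ℤ k → Vec ℤ k
_⊕_ = Vec.zipWith ℤ._+_

dot-⊕ : ∀ {k} (a x y : Vec ℤ k) → dot a (x ⊕ y) ≡ dot a x ℤ.+ dot a y
dot-⊕ []       []       []       = refl
dot-⊕ (a ∷ as) (x ∷ xs) (y ∷ ys) rewrite dot-⊕ as xs ys = eq a x y (dot as xs) (dot as ys)
  where
  eq : ∀ a x y u v → a ℤ.* (x ℤ.+ y) ℤ.+ (u ℤ.+ v) ≡ (a ℤ.* x ℤ.+ u) ℤ.+ (a ℤ.* y ℤ.+ v)
  eq = ℤSolver.solve-∀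

x+y≡z⇒y≡z-x : ∀ x {y z} → x ℤ.+ y ≡ z → y ≡ z ℤ.- x
x+y≡z⇒y≡z-x x {y} refl = eq x y
  where
  eq : ∀ x y → y ≡ (x ℤ.+ y) ℤ.- x
  eq = ℤSolver.solve-∀

x+y≡z⇒x≡z-y : ∀ {x} y {z} → x ℤ.+ y ≡ z → x ≡ z ℤ.- y
x+y≡z⇒x≡z-y {x} y eq = x+y≡z⇒y≡z-x y (trans (ℤ.+-comm y x) eq)

*-cancelˡ : ∀ {a} x y → a ≢ 0ℤ → a ℤ.* x ≡ a ℤ.* y → x ≡ y
*-cancelˡ {a} x y a≢0 = ℤ.*-cancelˡ-≡ a x y {{ℤ.≢-nonZero a≢0}}

⟦⟧-injective : ∀ {n} {i j : Fin n} → ⟦ i ⟧ ≡ ⟦ j ⟧ → i ≡ j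
⟦⟧-injective eq = Fin.toℕ-injective (ℕ.suc-injective (ℤ.+-injective eq))

-- `F` is defined on all integer vectors because it will be evaluated at translates of box points,
-- which may leave the box.
box : ∀ n k → (Vec ℤ k → ℕ) → ℕ
box n k F = ∑ⱽ n k (λ x → F (Vec.map ⟦_⟧ x))

-- The level `s` is arbitrary because fixing a coordinate (`slice`) or shifting the argument
-- (`translate`) changes it.
record OnHyperplane {k} (a : Vec ℤ k) (s : ℤ) (M : ℕ) (F : Vec ℤ k → ℕ) : Set where
  field
    F≤M     : ∀ t → F t ≤ M
    support : ∀ t → F t ≢ 0 → dot a t ≡ s
open OnHyperplane

slice : ∀ {k a s M F} {as : Vec ℤ k} → OnHyperplane (a ∷ as) s M F →
        ∀ x → OnHyperplane as (s ℤ.- a ℤ.* x) M (λ t → F (x ∷ t))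
slice h x .F≤M t = F≤M h (x ∷ t)
slice {a = a} h x .support t ≢0 = x+y≡z⇒y≡z-x (a ℤ.* x) (support h (x ∷ t) ≢0)

translate : ∀ {k s M F} {a : Vec ℤ k} → OnHyperplane a s M F →
            ∀ v → OnHyperplane a (s ℤ.- dot a v) M (λ t → F (t ⊕ v))
translate h v .F≤M t = F≤M h (t ⊕ v)
translate {a = a} h v .support t ≢0 =
  x+y≡z⇒x≡z-y (dot a v) (trans (sym (dot-⊕ a t v)) (support h (t ⊕ v) ≢0))

∑-hyperplane : ∀ {k a s M F} {as : Vec ℤ k} → a ≢ 0ℤ → OnHyperplane (a ∷ as) s M F →
               ∀ n t → ∑[ i < n ] F (⟦ i ⟧ ∷ t) ≤ M
∑-hyperplane {a = a} {F = F} {as = as} a≢0 h n t =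
  ∑-support≤1 (λ (i : Fin n) → F (⟦ i ⟧ ∷ t)) (λ i → F≤M h (⟦ i ⟧ ∷ t)) λ i j p q →
    ⟦⟧-injective (*-cancelˡ ⟦ i ⟧ ⟦ j ⟧ a≢0
      (trans (x+y≡z⇒x≡z-y (dot as t) (support h _ p)) (sym (x+y≡z⇒x≡z-y (dot as t) (support h _ q)))))

-- Coordinates are fixed one at a time until a single one remains, and that one is determined.
box-hyperplane : ∀ {d s M F} {a : Vec ℤ (suc d)} → All (_≢ 0ℤ) a → OnHyperplane a s M F →
                 ∀ n → box n (suc d) F ≤ n ^ d * M
box-hyperplane {zero} {M = M} {a = a ∷ []} (a≢0 ∷ []) h n =
  ℕ.≤-trans (∑-hyperplane a≢0 h n []) (ℕ.≤-reflexive (sym (ℕ.*-identityˡ M)))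
box-hyperplane {suc d} {M = M} {F} {a ∷ as} (_ ∷ as≢0) h n = begin
  ∑[ i < n ] box n (suc d) (λ t → F (⟦ i ⟧ ∷ t))  ≤⟨ ∑-mono (λ (i : Fin n) → box-hyperplane as≢0 (slice h ⟦ i ⟧) n) ⟩
  ∑[ i < n ] (n ^ d * M)                          ≡⟨ ∑-const n _ ⟩
  n * (n ^ d * M)                                 ≡⟨ ℕ.*-assoc n (n ^ d) M ⟨
  n ^ suc d * M                                   ∎
  where open ℕ.≤-Reasoning

-- Both sides are ψ(0) + ... + ψ(n).
∑-telescope : ∀ n (ψ : ℕ → ℕ) → ∑[ i < n ] ψ (toℕ i) + ψ n ≡ ψ 0 + ∑[ i < n ] ψ (suc (toℕ i))
∑-telescope zero    ψ = ℕ.+-comm 0 (ψ 0)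
∑-telescope (suc n) ψ = trans (ℕ.+-assoc (ψ 0) _ _) (cong (_+_ (ψ 0)) (∑-telescope n (ψ ∘ suc)))

-- A shift by one exchanges one end term for another, and the term lost is at most `M`; a shift by
-- `m` is `m` such steps.
∑-shift⁺ : ∀ n (Φ : ℤ → ℕ) {M} → (∀ x → Φ x ≤ M) → ∀ m →
           ∑[ i < n ] Φ ⟦ i ⟧ ≤ ∑[ i < n ] Φ (⟦ i ⟧ ℤ.+ (+ m)) + m * M
∑-shift⁺ n Φ {M} Φ≤M zero =
  ℕ.≤-reflexive (sym (trans (ℕ.+-identityʳ _) (sum-cong-≗ λ (i : Fin n) → cong Φ (ℤ.+-identityʳ ⟦ i ⟧))))
∑-shift⁺ n Φ {M} Φ≤M (suc m) = begin
  ∑[ i < n ] Φ ⟦ i ⟧                              ≤⟨ ∑-shift⁺ n Φ Φ≤M m ⟩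
  ∑[ i < n ] ψ (toℕ i) + m * M                    ≤⟨ ℕ.+-monoˡ-≤ (m * M) (ℕ.m≤m+n _ (ψ n)) ⟩
  ∑[ i < n ] ψ (toℕ i) + ψ n + m * M              ≡⟨ cong (_+ m * M) (∑-telescope n ψ) ⟩
  ψ 0 + ∑[ i < n ] ψ (suc (toℕ i)) + m * M        ≤⟨ ℕ.+-monoˡ-≤ (m * M) (ℕ.+-monoˡ-≤ _ (Φ≤M _)) ⟩
  M + ∑[ i < n ] ψ (suc (toℕ i)) + m * M          ≡⟨ eq M _ (m * M) ⟩
  ∑[ i < n ] ψ (suc (toℕ i)) + (M + m * M)        ≡⟨ cong (_+ (M + m * M)) (sum-cong-≗ λ (i : Fin n) → cong (λ x → Φ (+ x)) (sym (ℕ.+-suc (suc (toℕ i)) m))) ⟩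
  ∑[ i < n ] Φ (⟦ i ⟧ ℤ.+ (+ suc m)) + suc m * M  ∎
  where
  open ℕ.≤-Reasoning
  ψ : ℕ → ℕ
  ψ x = Φ (+ suc x ℤ.+ + m)
  eq : ∀ x y z → x + y + z ≡ y + (x + z)
  eq = ℕSolver.solve-∀

∑-shift⁻ : ∀ n (Φ : ℤ → ℕ) {M} → (∀ x → Φ x ≤ M) → ∀ m →
           ∑[ i < n ] Φ ⟦ i ⟧ ≤ ∑[ i < n ] Φ (⟦ i ⟧ ℤ.- (+ m)) + m * M
∑-shift⁻ n Φ {M} Φ≤M zero =
  ℕ.≤-reflexive (sym (trans (ℕ.+-identityʳ _) (sum-cong-≗ λ (i : Fin n) → cong Φ (ℤ.+-identityʳ ⟦ i ⟧))))
∑-shift⁻ n Φ {M} Φ≤M (suc m) = begin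
  ∑[ i < n ] Φ ⟦ i ⟧                              ≤⟨ ∑-shift⁻ n Φ Φ≤M m ⟩
  ∑[ i < n ] ψ (suc (toℕ i)) + m * M              ≤⟨ ℕ.+-monoˡ-≤ (m * M) (ℕ.m≤n+m _ (ψ 0)) ⟩
  ψ 0 + ∑[ i < n ] ψ (suc (toℕ i)) + m * M        ≡⟨ cong (_+ m * M) (∑-telescope n ψ) ⟨
  ∑[ i < n ] ψ (toℕ i) + ψ n + m * M              ≤⟨ ℕ.+-monoˡ-≤ (m * M) (ℕ.+-monoʳ-≤ _ (Φ≤M _)) ⟩
  ∑[ i < n ] ψ (toℕ i) + M + m * M                ≡⟨ ℕ.+-assoc _ M (m * M) ⟩
  ∑[ i < n ] ψ (toℕ i) + (M + m * M)              ≡⟨ cong (_+ (M + m * M)) (sum-cong-≗ λ (i : Fin n) → cong Φ (eq (+ toℕ i) (+ m))) ⟩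
  ∑[ i < n ] Φ (⟦ i ⟧ ℤ.- (+ suc m)) + suc m * M  ∎
  where
  open ℕ.≤-Reasoning
  ψ : ℕ → ℕ
  ψ x = Φ (+ x ℤ.- (+ m))
  eq : ∀ x m → x ℤ.- m ≡ (1ℤ ℤ.+ x) ℤ.- (1ℤ ℤ.+ m)
  eq = ℤSolver.solve-∀

∑-shift : ∀ n (Φ : ℤ → ℕ) {M} → (∀ x → Φ x ≤ M) → ∀ v →
          ∑[ i < n ] Φ ⟦ i ⟧ ≤ ∑[ i < n ] Φ (⟦ i ⟧ ℤ.+ v) + ∣ v ∣ * M
∑-shift n Φ Φ≤M (+ m)    = ∑-shift⁺ n Φ Φ≤M m
∑-shift n Φ Φ≤M -[1+ m ] = ∑-shift⁻ n Φ Φ≤M (suc m)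

‖_‖ : ∀ {k} → Vec ℤ k → ℕ
‖ [] ‖    = 0
‖ v ∷ vs ‖ = ∣ v ∣ + ‖ vs ‖

-- Shifting one coordinate by v costs |v| times the largest slice. A slice of a hyperplane in
-- `2 + j` coordinates has mass at most `n ^ j * M`, one power of `n` below the bound for the whole,
-- so the coordinates are shifted separately: the tail with the first coordinate fixed, then the
-- first.
box-shift-tail : ∀ {j s M F} {a : Vec ℤ (2 + j)} → All (_≢ 0ℤ) a → OnHyperplane a s M F →
  ∀ n vs → box n (2 + j) F ≤ ∑[ i < n ] box n (1 + j) (λ t → F (⟦ i ⟧ ∷ t ⊕ vs)) + n ^ j * (‖ vs ‖ * M)
box-shift : ∀ {j s M F} {a : Vec ℤ (2 + j)} → All (_≢ 0ℤ) a → OnHyperplane a s M F →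
  ∀ n v → box n (2 + j) F ≤ box n (2 + j) (λ t → F (t ⊕ v)) + n ^ j * (‖ v ‖ * M)

-- With one tail coordinate left, the first is summed inside: fixing it would cost up to `M` for
-- each of its `n` values, whereas the inner sum over it is at most `M` in total.
box-shift-tail {zero} {M = M} {F} (a≢0 ∷ b≢0 ∷ []) h n (v ∷ []) = begin
  ∑[ i < n ] ∑[ j < n ] F (⟦ i ⟧ ∷ ⟦ j ⟧ ∷ [])                                    ≡⟨ ∑-comm (λ (i j : Fin n) → F (⟦ i ⟧ ∷ ⟦ j ⟧ ∷ [])) ⟩
  ∑[ j < n ] ∑[ i < n ] F (⟦ i ⟧ ∷ ⟦ j ⟧ ∷ [])                                    ≤⟨ ∑-shift n (λ y → ∑[ i < n ] F (⟦ i ⟧ ∷ y ∷ [])) (λ y → ∑-hyperplane a≢0 h n (y ∷ [])) v ⟩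
  ∑[ j < n ] ∑[ i < n ] F (⟦ i ⟧ ∷ ⟦ j ⟧ ℤ.+ v ∷ []) + ∣ v ∣ * M                  ≡⟨ cong₂ _+_ (∑-comm (λ (j i : Fin n) → F (⟦ i ⟧ ∷ ⟦ j ⟧ ℤ.+ v ∷ []))) (eq ∣ v ∣ M) ⟩
  ∑[ i < n ] ∑[ j < n ] F (⟦ i ⟧ ∷ ⟦ j ⟧ ℤ.+ v ∷ []) + 1 * ((∣ v ∣ + 0) * M)      ∎
  where
  open ℕ.≤-Reasoning
  eq : ∀ v M → v * M ≡ 1 * ((v + 0) * M)
  eq = ℕSolver.solve-∀
box-shift-tail {suc j} {M = M} {F} (_ ∷ as≢0) h n vs = begin
  ∑[ i < n ] box n (2 + j) (λ t → F (⟦ i ⟧ ∷ t))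
    ≤⟨ ∑-mono (λ (i : Fin n) → box-shift as≢0 (slice h ⟦ i ⟧) n vs) ⟩
  ∑[ i < n ] (G i + e)
    ≡⟨ ∑-distrib-+ G (λ _ → e) ⟩
  sum G + ∑[ i < n ] e
    ≡⟨ cong (_+_ (sum G)) (trans (∑-const n e) (sym (ℕ.*-assoc n (n ^ j) _))) ⟩
  sum G + n ^ suc j * (‖ vs ‖ * M)  ∎
  where
  open ℕ.≤-Reasoning
  G : Fin n → ℕ
  G i = box n (2 + j) (λ t → F (⟦ i ⟧ ∷ t ⊕ vs))
  e : ℕ
  e = n ^ j * (‖ vs ‖ * M)

box-shift {j} {M = M} {F} as≢0@(_ ∷ a≢0) h n (v ∷ vs) = begin
  box n (2 + j) F
    ≤⟨ box-shift-tail as≢0 h n vs ⟩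
  ∑[ i < n ] Φ ⟦ i ⟧ + n ^ j * (‖ vs ‖ * M)
    ≤⟨ ℕ.+-monoˡ-≤ _ (∑-shift n Φ (λ x → box-hyperplane a≢0 (translate (slice h x) vs) n) v) ⟩
  ∑[ i < n ] Φ (⟦ i ⟧ ℤ.+ v) + ∣ v ∣ * (n ^ j * M) + n ^ j * (‖ vs ‖ * M)
    ≡⟨ eq (∑[ i < n ] Φ (⟦ i ⟧ ℤ.+ v)) ∣ v ∣ (n ^ j) M ‖ vs ‖ ⟩
  ∑[ i < n ] Φ (⟦ i ⟧ ℤ.+ v) + n ^ j * ((∣ v ∣ + ‖ vs ‖) * M)  ∎
  where
  open ℕ.≤-Reasoning
  Φ : ℤ → ℕ
  Φ x = box n (suc j) (λ t → F (x ∷ t ⊕ vs))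
  eq : ∀ s v N M w → s + v * (N * M) + N * (w * M) ≡ s + N * ((v + w) * M)
  eq = ℕSolver.solve-∀

-- Averaging over residues

∏ : ∀ {k} → (ℤ → ℕ) → Vec ℤ k → ℕ
∏ φ []       = 1
∏ φ (x ∷ xs) = φ x * ∏ φ xs


Σℤ-affine : ∀ n (D E : Fin n → ℤ) α β γ →
  Σℤ.sum (λ i → α ℤ.+ β ℤ.* D i ℤ.+ γ ℤ.* E i) ≡ + n ℤ.* α ℤ.+ β ℤ.* Σℤ.sum D ℤ.+ γ ℤ.* Σℤ.sum E
Σℤ-affine zero    D E α β γ = eq α β γ
  where
  eq : ∀ α β γ → 0ℤ ≡ 0ℤ ℤ.* α ℤ.+ β ℤ.* 0ℤ ℤ.+ γ ℤ.* 0ℤ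
  eq = ℤSolver.solve-∀
Σℤ-affine (suc n) D E α β γ =
  trans (cong (ℤ._+_ (α ℤ.+ β ℤ.* D zero ℤ.+ γ ℤ.* E zero)) (Σℤ-affine n (D ∘ suc) (E ∘ suc) α β γ))
        (eq (+ n) (D zero) (E zero) α β γ _ _)
  where
  eq : ∀ n d e α β γ D E → (α ℤ.+ β ℤ.* d ℤ.+ γ ℤ.* e) ℤ.+ (n ℤ.* α ℤ.+ β ℤ.* D ℤ.+ γ ℤ.* E)
       ≡ (1ℤ ℤ.+ n) ℤ.* α ℤ.+ β ℤ.* (d ℤ.+ D) ℤ.+ γ ℤ.* (e ℤ.+ E)
  eq = ℤSolver.solve-∀

residues : ∀ {p d} → Vec (Fin p) d → Vec ℤ d
residues = Vec.map (λ v → + toℕ v)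

module Residues (p : ℕ) .{{_ : NonZero p}} where

  δ : ℤ → ℕ
  δ x = ind (+ p ∣? x)

  -- The negative of an inverse is stored because the modulus 1 + ∏ ∣aᵢ∣ provides it directly: aᵢ
  -- times its signed cofactor is ∏ ∣aᵢ∣, which is -1 modulo p.
  record Invertible (a : ℤ) : Set where
    constructor -1/≡
    field
      neg-inverse   : ℤ
      p∣a*inverse+1 : + p ∣ a ℤ.* neg-inverse ℤ.+ 1ℤ

  δ-* : ∀ {a} → Invertible a → ∀ x → δ (a ℤ.* x) ≡ δ x
  δ-* {a} (-1/≡ c p∣ac+1) x = ind-⇔ (+ p ∣? _) (+ p ∣? _) to (∣n⇒∣m*n a)
    where
    eq : ∀ a c x → (a ℤ.* c ℤ.+ 1ℤ) ℤ.* x ℤ.- c ℤ.* (a ℤ.* x) ≡ x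
    eq = ℤSolver.solve-∀
    to : + p ∣ a ℤ.* x → + p ∣ x
    to p∣ax = subst (+ p ∣_) (eq a c x) (∣m∣n⇒∣m-n (∣m⇒∣m*n x p∣ac+1) (∣n⇒∣m*n c p∣ax))

  δ-+ : ∀ x {y} → + p ∣ y → δ (x ℤ.+ y) ≡ δ x
  δ-+ x p∣y = ind-⇔ (+ p ∣? _) (+ p ∣? _) (λ p∣x+y → ∣m+n∣n⇒∣m p∣x+y p∣y) (λ p∣x → ∣m∣n⇒∣m+n p∣x p∣y)

  Invertible-neg-* : ∀ {a b} → Invertible a → Invertible b → Invertible (ℤ.- (a ℤ.* b))
  Invertible-neg-* {a} {b} (-1/≡ c p∣ac+1) (-1/≡ d p∣bd+1) = -1/≡ (c ℤ.* d)
    (subst (+ p ∣_) (eq a b c d)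
      (∣m∣n⇒∣m-n p∣ac+1 (∣n⇒∣m*n (a ℤ.* c) p∣bd+1)))
    where
    eq : ∀ a b c d → (a ℤ.* c ℤ.+ 1ℤ) ℤ.- (a ℤ.* c) ℤ.* (b ℤ.* d ℤ.+ 1ℤ) ≡ ℤ.- (a ℤ.* b) ℤ.* (c ℤ.* d) ℤ.+ 1ℤ
    eq = ℤSolver.solve-∀

  ∣i-j∣⇒i≡j : ∀ (i j : Fin p) → + p ∣ + toℕ i ℤ.- + toℕ j → i ≡ j
  ∣i-j∣⇒i≡j i j p∣i-j with ∣ + toℕ i ℤ.- + toℕ j ∣ in eq | ∣⇒∣ᵤ p∣i-j
  ... | zero  | _ = Fin.toℕ-injective (ℤ.+-injective (ℤ.i-j≡0⇒i≡j _ _ (ℤ.∣i∣≡0⇒i≡0 eq)))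
  ... | suc m | p∣d = contradiction (ℕ.∣⇒≤ p∣d) (ℕ.<⇒≱ d<p)
    where
    open ℕ.≤-Reasoning
    d<p : suc m < p
    d<p = begin-strict
      suc m                        ≡⟨ eq ⟨
      ∣ + toℕ i ℤ.- + toℕ j ∣      ≡⟨ cong ∣_∣ (ℤ.m-n≡m⊖n (toℕ i) (toℕ j)) ⟩
      ∣ toℕ i ℤ.⊖ toℕ j ∣          ≤⟨ ℤ.∣m⊝n∣≤m⊔n (toℕ i) (toℕ j) ⟩
      toℕ i ℕ.⊔ toℕ j       <⟨ ℕ.⊔-lub (Fin.toℕ<n i) (Fin.toℕ<n j) ⟩
      p                            ∎

  ∑δ- : ∀ x → ∑[ v < p ] δ (x ℤ.- + toℕ v) ≡ 1
  ∑δ- x = ℕ.≤-antisym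
    (∑-support≤1 f (λ v → ind≤1 (+ p ∣? _)) λ i j p q → ∣i-j∣⇒i≡j i j
      (subst (+ _ ∣_) (eq₁ x (+ toℕ i) (+ toℕ j))
        (∣m∣n⇒∣m-n (ind≢0 (+ _ ∣? _) q) (ind≢0 (+ _ ∣? _) p))))
    (subst (_≤ sum f) (ind-true (+ p ∣? _) p∣x-r) (term≤∑ f (fromℕ< (n%ℕd<d x p))))
    where
    f : Fin p → ℕ
    f v = δ (x ℤ.- + toℕ v)
    eq₁ : ∀ x i j → (x ℤ.- j) ℤ.- (x ℤ.- i) ≡ i ℤ.- j
    eq₁ = ℤSolver.solve-∀
    eq₂ : ∀ r t → (r ℤ.+ t) ℤ.- r ≡ t
    eq₂ = ℤSolver.solve-∀
    p∣x-r : + p ∣ x ℤ.- + toℕ (fromℕ< (n%ℕd<d x p))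
    p∣x-r = divides (x /ℕ p) (trans
      (cong₂ ℤ._-_ (a≡a%ℕn+[a/ℕn]*n x p) (cong +_ (Fin.toℕ-fromℕ< (n%ℕd<d x p))))
      (eq₂ (+ (x %ℕ p)) _))

  -- Multiplication by the negated inverse `c` turns a v into -v modulo p and preserves divisibility
  -- by p, which reduces the sum to `∑δ-`.
  ∑δ : ∀ {a} → Invertible a → ∀ x → ∑[ v < p ] δ (x ℤ.+ a ℤ.* + toℕ v) ≡ 1
  ∑δ {a} a⁻¹@(-1/≡ c p∣ac+1) x = trans (sum-cong-≗ λ (v : Fin p) → δ-step (+ toℕ v)) (∑δ- (c ℤ.* x))
    where
    eq₁ : ∀ a c → a ℤ.* c ℤ.+ 1ℤ ≡ c ℤ.* a ℤ.+ 1ℤ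
    eq₁ = ℤSolver.solve-∀
    eq₂ : ∀ a c x v → c ℤ.* (x ℤ.+ a ℤ.* v) ≡ (c ℤ.* x ℤ.- v) ℤ.+ (a ℤ.* c ℤ.+ 1ℤ) ℤ.* v
    eq₂ = ℤSolver.solve-∀
    δ-step : ∀ v → δ (x ℤ.+ a ℤ.* v) ≡ δ (c ℤ.* x ℤ.- v)
    δ-step v = begin
      δ (x ℤ.+ a ℤ.* v)                                  ≡⟨ δ-* (-1/≡ {c} a (subst (+ p ∣_) (eq₁ a c) p∣ac+1)) _ ⟨
      δ (c ℤ.* (x ℤ.+ a ℤ.* v))                          ≡⟨ cong δ (eq₂ a c x v) ⟩
      δ ((c ℤ.* x ℤ.- v) ℤ.+ (a ℤ.* c ℤ.+ 1ℤ) ℤ.* v)      ≡⟨ δ-+ _ (∣m⇒∣m*n v p∣ac+1) ⟩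
      δ (c ℤ.* x ℤ.- v)                                  ∎
      where open ≡-Reasoning

  g : ℤ → ℤ
  g x = + p ℤ.* + δ x ℤ.- 1ℤ

  -- Multiplying the tail by `a` lets an integer head compensate exactly, so these shifts take
  -- integer solutions to integer solutions. When `a` is invertible modulo p, the tails run through
  -- all residue vectors, so the shifts cover each solution modulo p once.
  kernelVector : ∀ {d} → ℤ → Vec ℤ d → Vec (Fin p) d → Vec ℤ (suc d)
  kernelVector a as u = ℤ.- dot as (residues u) ∷ Vec.map (a ℤ.*_) (residues u)

  dot-kernelVector : ∀ {d} a (as : Vec ℤ d) u → dot (a ∷ as) (kernelVector a as u) ≡ 0ℤ
  dot-kernelVector a as u = trans (cong (ℤ._+_ (a ℤ.* _)) (dot-map as (residues u))) (eq a (dot as (residues u)))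
    where
    eq : ∀ a w → a ℤ.* (ℤ.- w) ℤ.+ a ℤ.* w ≡ 0ℤ
    eq = ℤSolver.solve-∀
    eq′ : ∀ a b v w → b ℤ.* (a ℤ.* v) ℤ.+ a ℤ.* w ≡ a ℤ.* (b ℤ.* v ℤ.+ w)
    eq′ = ℤSolver.solve-∀
    dot-map : ∀ {d} (bs vs : Vec ℤ d) → dot bs (Vec.map (a ℤ.*_) vs) ≡ a ℤ.* dot bs vs
    dot-map []       []       = sym (ℤ.*-zeroʳ a)
    dot-map (b ∷ bs) (v ∷ vs) rewrite dot-map bs vs = eq′ a b v (dot bs vs)

  module _ (φ : ℤ → ℕ) (B c : ℤ) (φ≡B+cg : ∀ x → + φ x ≡ B ℤ.+ c ℤ.* g x)
           {a : ℤ} (a⁻¹ : Invertible a) where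

    -- g is, up to the factor p, idempotent for the convolution on ℤ/p and orthogonal to constants.
    convolution : ∀ {b} → Invertible b → ∀ K X Y x y z → let s = a ℤ.* y ℤ.+ (b ℤ.* z ℤ.+ x) in
      Σℤ.sum {p} (λ v → + φ (z ℤ.+ a ℤ.* + toℕ v) ℤ.*
                        (K ℤ.* (X ℤ.+ Y ℤ.* g (a ℤ.* (y ℤ.- b ℤ.* + toℕ v) ℤ.+ x))))
      ≡ + p ℤ.* K ℤ.* (B ℤ.* X ℤ.+ c ℤ.* Y ℤ.* g s)
    convolution {b} b⁻¹ K X Y x y z = begin
      Σℤ.sum (λ (v : Fin p) → + φ (z ℤ.+ a ℤ.* + toℕ v) ℤ.* (K ℤ.* (X ℤ.+ Y ℤ.* g (a ℤ.* (y ℤ.- b ℤ.* + toℕ v) ℤ.+ x))))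
        ≡⟨ Σℤ.sum-cong-≗ (λ (v : Fin p) → summand (+ toℕ v)) ⟩
      Σℤ.sum (λ v → α ℤ.+ β ℤ.* + D v ℤ.+ γ ℤ.* + E v)
        ≡⟨ Σℤ-affine p (λ v → + D v) (λ v → + E v) α β γ ⟩
      + p ℤ.* α ℤ.+ β ℤ.* Σℤ.sum (λ v → + D v) ℤ.+ γ ℤ.* Σℤ.sum (λ v → + E v)
        ≡⟨ cong₂ (λ d e → + p ℤ.* α ℤ.+ β ℤ.* d ℤ.+ γ ℤ.* e)
             (trans (sym (pos-sum D)) (cong +_ (∑δ a⁻¹ z)))
             (trans (sym (pos-sum E)) (cong +_ (∑δ (Invertible-neg-* a⁻¹ b⁻¹) (a ℤ.* y ℤ.+ x)))) ⟩
      + p ℤ.* α ℤ.+ β ℤ.* 1ℤ ℤ.+ γ ℤ.* 1ℤ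
        ≡⟨ total (+ p) K X Y B c S ⟩
      + p ℤ.* K ℤ.* (B ℤ.* X ℤ.+ c ℤ.* Y ℤ.* g s) ∎
      where
      open ≡-Reasoning
      s S α β γ : ℤ
      s = a ℤ.* y ℤ.+ (b ℤ.* z ℤ.+ x)
      S = + δ s
      α = K ℤ.* (B ℤ.- c) ℤ.* (X ℤ.- Y)
      β = K ℤ.* c ℤ.* + p ℤ.* (X ℤ.- Y ℤ.+ + p ℤ.* Y ℤ.* S)
      γ = K ℤ.* (B ℤ.- c) ℤ.* + p ℤ.* Y
      D E : Fin p → ℕ
      D v = δ (z ℤ.+ a ℤ.* + toℕ v)
      E v = δ ((a ℤ.* y ℤ.+ x) ℤ.+ ℤ.- (a ℤ.* b) ℤ.* + toℕ v)
      total : ∀ p K X Y B c S →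
        p ℤ.* (K ℤ.* (B ℤ.- c) ℤ.* (X ℤ.- Y)) ℤ.+ (K ℤ.* c ℤ.* p ℤ.* (X ℤ.- Y ℤ.+ p ℤ.* Y ℤ.* S)) ℤ.* 1ℤ
          ℤ.+ (K ℤ.* (B ℤ.- c) ℤ.* p ℤ.* Y) ℤ.* 1ℤ
        ≡ p ℤ.* K ℤ.* (B ℤ.* X ℤ.+ c ℤ.* Y ℤ.* (p ℤ.* S ℤ.- 1ℤ))
      total = ℤSolver.solve-∀
      eq₁ : ∀ a b x y v → a ℤ.* (y ℤ.- b ℤ.* v) ℤ.+ x ≡ (a ℤ.* y ℤ.+ x) ℤ.+ ℤ.- (a ℤ.* b) ℤ.* v
      eq₁ = ℤSolver.solve-∀
      eq₂ : ∀ a b x y z v → (a ℤ.* y ℤ.+ x) ℤ.+ ℤ.- (a ℤ.* b) ℤ.* v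
            ≡ (a ℤ.* y ℤ.+ (b ℤ.* z ℤ.+ x)) ℤ.+ ℤ.- b ℤ.* (z ℤ.+ a ℤ.* v)
      eq₂ = ℤSolver.solve-∀
      expand : ∀ p K X Y B c D E → (B ℤ.+ c ℤ.* (p ℤ.* D ℤ.- 1ℤ)) ℤ.* (K ℤ.* (X ℤ.+ Y ℤ.* (p ℤ.* E ℤ.- 1ℤ)))
        ≡ (K ℤ.* (B ℤ.- c) ℤ.* (X ℤ.- Y)) ℤ.+ (K ℤ.* c ℤ.* p ℤ.* (X ℤ.- Y)) ℤ.* D
          ℤ.+ (K ℤ.* c ℤ.* p ℤ.* p ℤ.* Y) ℤ.* (D ℤ.* E) ℤ.+ (K ℤ.* (B ℤ.- c) ℤ.* p ℤ.* Y) ℤ.* E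
      expand = ℤSolver.solve-∀
      collect : ∀ p K X Y B c D E S →
        (K ℤ.* (B ℤ.- c) ℤ.* (X ℤ.- Y)) ℤ.+ (K ℤ.* c ℤ.* p ℤ.* (X ℤ.- Y)) ℤ.* D
          ℤ.+ (K ℤ.* c ℤ.* p ℤ.* p ℤ.* Y) ℤ.* (D ℤ.* S) ℤ.+ (K ℤ.* (B ℤ.- c) ℤ.* p ℤ.* Y) ℤ.* E
        ≡ (K ℤ.* (B ℤ.- c) ℤ.* (X ℤ.- Y)) ℤ.+ (K ℤ.* c ℤ.* p ℤ.* (X ℤ.- Y ℤ.+ p ℤ.* Y ℤ.* S)) ℤ.* D
          ℤ.+ (K ℤ.* (B ℤ.- c) ℤ.* p ℤ.* Y) ℤ.* E
      collect = ℤSolver.solve-∀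
      -- Either `δ z′` is 0, or p divides z′ and then the other argument is congruent to `s`. So the
      -- product of the two indicators is `δ z′` times a constant, and the summand becomes affine in
      -- the indicators.
      δ-product : ∀ z′ {t} → (+ p ∣ z′ → δ t ≡ δ s) → + δ z′ ℤ.* + δ t ≡ + δ z′ ℤ.* S
      δ-product z′ δt≡δs with + p ∣? z′
      ... | yes p∣z′ = cong (λ x → 1ℤ ℤ.* + x) (δt≡δs p∣z′)
      ... | no  _    = refl
      summand : ∀ v → + φ (z ℤ.+ a ℤ.* v) ℤ.* (K ℤ.* (X ℤ.+ Y ℤ.* g (a ℤ.* (y ℤ.- b ℤ.* v) ℤ.+ x)))
        ≡ α ℤ.+ β ℤ.* + δ (z ℤ.+ a ℤ.* v) ℤ.+ γ ℤ.* + δ ((a ℤ.* y ℤ.+ x) ℤ.+ ℤ.- (a ℤ.* b) ℤ.* v)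
      summand v = begin
        + φ z′ ℤ.* (K ℤ.* (X ℤ.+ Y ℤ.* g (a ℤ.* (y ℤ.- b ℤ.* v) ℤ.+ x)))
          ≡⟨ cong₂ (λ w t → w ℤ.* (K ℤ.* (X ℤ.+ Y ℤ.* g t))) (φ≡B+cg z′) (eq₁ a b x y v) ⟩
        (B ℤ.+ c ℤ.* g z′) ℤ.* (K ℤ.* (X ℤ.+ Y ℤ.* g t))
          ≡⟨ expand (+ p) K X Y B c (+ δ z′) (+ δ t) ⟩
        α ℤ.+ (K ℤ.* c ℤ.* + p ℤ.* (X ℤ.- Y)) ℤ.* + δ z′ ℤ.+ (K ℤ.* c ℤ.* + p ℤ.* + p ℤ.* Y) ℤ.* (+ δ z′ ℤ.* + δ t) ℤ.+ γ ℤ.* + δ t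
          ≡⟨ cong (λ w → α ℤ.+ (K ℤ.* c ℤ.* + p ℤ.* (X ℤ.- Y)) ℤ.* + δ z′ ℤ.+ (K ℤ.* c ℤ.* + p ℤ.* + p ℤ.* Y) ℤ.* w ℤ.+ γ ℤ.* + δ t)
               (δ-product z′ λ p∣z′ → trans (cong δ (eq₂ a b x y z v)) (δ-+ s (∣n⇒∣m*n (ℤ.- b) p∣z′))) ⟩
        α ℤ.+ (K ℤ.* c ℤ.* + p ℤ.* (X ℤ.- Y)) ℤ.* + δ z′ ℤ.+ (K ℤ.* c ℤ.* + p ℤ.* + p ℤ.* Y) ℤ.* (+ δ z′ ℤ.* S) ℤ.+ γ ℤ.* + δ t
          ≡⟨ collect (+ p) K X Y B c (+ δ z′) (+ δ t) S ⟩
        α ℤ.+ β ℤ.* + δ z′ ℤ.+ γ ℤ.* + δ t ∎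
        where
        z′ t : ℤ
        z′ = z ℤ.+ a ℤ.* v
        t = (a ℤ.* y ℤ.+ x) ℤ.+ ℤ.- (a ℤ.* b) ℤ.* v

    -- Induction on the number of free residues: fixing the first one, v, moves the head to y - b v,
    -- and `convolution` sums the induction hypothesis over v. The moved point need not be a
    -- solution of the shorter equation, so x is arbitrary and the value carries `g` of its dot
    -- product.
    ∑-kernelVector : ∀ {d} {as : Vec ℤ d} → All Invertible as → ∀ x →
      + ∑ⱽ p d (λ u → ∏ φ (x ⊕ kernelVector a as u))
      ≡ (+ p) ℤ.^ d ℤ.* (B ℤ.^ suc d ℤ.+ c ℤ.^ suc d ℤ.* g (dot (a ∷ as) x))
    ∑-kernelVector [] (y ∷ []) = begin
      + (φ (y ℤ.+ 0ℤ) * 1)                                ≡⟨ cong +_ (trans (ℕ.*-identityʳ _) (cong φ (ℤ.+-identityʳ y))) ⟩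
      + φ y                                               ≡⟨ φ≡B+cg y ⟩
      B ℤ.+ c ℤ.* (+ p ℤ.* + δ y ℤ.- 1ℤ)                  ≡⟨ cong (λ d → B ℤ.+ c ℤ.* (+ p ℤ.* + d ℤ.- 1ℤ)) (δ-* a⁻¹ y) ⟨
      B ℤ.+ c ℤ.* g (a ℤ.* y)                             ≡⟨ cong (λ t → B ℤ.+ c ℤ.* g t) (sym (ℤ.+-identityʳ (a ℤ.* y))) ⟩
      B ℤ.+ c ℤ.* g (a ℤ.* y ℤ.+ 0ℤ)                      ≡⟨ eq B c (g (a ℤ.* y ℤ.+ 0ℤ)) ⟩
      1ℤ ℤ.* (B ℤ.* 1ℤ ℤ.+ c ℤ.* 1ℤ ℤ.* g (a ℤ.* y ℤ.+ 0ℤ)) ∎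
      where
      open ≡-Reasoning
      eq : ∀ B c g → B ℤ.+ c ℤ.* g ≡ 1ℤ ℤ.* (B ℤ.* 1ℤ ℤ.+ c ℤ.* 1ℤ ℤ.* g)
      eq = ℤSolver.solve-∀
    ∑-kernelVector {suc d} {b ∷ bs} (b⁻¹ ∷ bs⁻¹) (y ∷ z ∷ x) = begin
      + ∑ⱽ p (suc d) (λ u → ∏ φ ((y ∷ z ∷ x) ⊕ kernelVector a (b ∷ bs) u))
        ≡⟨ cong +_ (sum-cong-≗ λ (v : Fin p) → trans (∑ⱽ-cong p d (factor v)) (sym (*-distribˡ-∑ⱽ p d (φ (z ℤ.+ a ℤ.* + toℕ v)) (rest v)))) ⟩
      + ∑[ v < p ] (φ (z ℤ.+ a ℤ.* + toℕ v) * ∑ⱽ p d (rest v))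
        ≡⟨ pos-sum (λ (v : Fin p) → φ (z ℤ.+ a ℤ.* + toℕ v) * ∑ⱽ p d (rest v)) ⟩
      Σℤ.sum (λ (v : Fin p) → + (φ (z ℤ.+ a ℤ.* + toℕ v) * ∑ⱽ p d (rest v)))
        ≡⟨ Σℤ.sum-cong-≗ (λ (v : Fin p) → trans (ℤ.pos-* (φ (z ℤ.+ a ℤ.* + toℕ v)) _)
             (cong (ℤ._*_ (+ φ (z ℤ.+ a ℤ.* + toℕ v))) (∑-kernelVector bs⁻¹ (y ℤ.- b ℤ.* + toℕ v ∷ x)))) ⟩
      Σℤ.sum (λ (v : Fin p) → + φ (z ℤ.+ a ℤ.* + toℕ v) ℤ.* ((+ p) ℤ.^ d ℤ.*
        (B ℤ.^ suc d ℤ.+ c ℤ.^ suc d ℤ.* g (a ℤ.* (y ℤ.- b ℤ.* + toℕ v) ℤ.+ dot bs x))))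
        ≡⟨ convolution b⁻¹ ((+ p) ℤ.^ d) (B ℤ.^ suc d) (c ℤ.^ suc d) (dot bs x) y z ⟩
      (+ p) ℤ.^ suc d ℤ.* (B ℤ.^ suc (suc d) ℤ.+ c ℤ.^ suc (suc d) ℤ.* g (dot (a ∷ b ∷ bs) (y ∷ z ∷ x))) ∎
      where
      open ≡-Reasoning
      rest : Fin p → Vec (Fin p) d → ℕ
      rest v u = ∏ φ ((y ℤ.- b ℤ.* + toℕ v ∷ x) ⊕ kernelVector a bs u)
      eq : ∀ y s w → y ℤ.+ ℤ.- (s ℤ.+ w) ≡ (y ℤ.- s) ℤ.+ ℤ.- w
      eq = ℤSolver.solve-∀
      eq′ : ∀ f h k → f * (h * k) ≡ h * (f * k)
      eq′ = ℕSolver.solve-∀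
      factor : ∀ v u → ∏ φ ((y ∷ z ∷ x) ⊕ kernelVector a (b ∷ bs) (v ∷ u)) ≡ φ (z ℤ.+ a ℤ.* + toℕ v) * rest v u
      factor v u = trans
        (cong (λ t → φ t * (φ (z ℤ.+ a ℤ.* + toℕ v) * ∏ φ (x ⊕ Vec.map (a ℤ.*_) (residues u))))
              (eq y (b ℤ.* + toℕ v) (dot bs (residues u))))
        (eq′ (φ ((y ℤ.- b ℤ.* + toℕ v) ℤ.+ ℤ.- dot bs (residues u))) (φ (z ℤ.+ a ℤ.* + toℕ v)) _)

-- Choice of the modulus, and averaging over kernel shifts

∏≤^ : ∀ {k} (φ : ℤ → ℕ) {M} → (∀ x → φ x ≤ M) → ∀ (x : Vec ℤ k) → ∏ φ x ≤ M ^ k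
∏≤^ φ φ≤M []       = ℕ.≤-refl
∏≤^ φ φ≤M (x ∷ xs) = ℕ.*-mono-≤ (φ≤M x) (∏≤^ φ φ≤M xs)

-- With weights of constant sum L, this is Lᵏ times the probability that a tuple with distinct
-- entries becomes monochromatic when its entries are coloured independently.
weightedMass : ∀ {r k} → (Fin r → ℤ → ℕ) → Vec ℤ k → ℕ
weightedMass {r} weight x = ∑[ i < r ] ∏ (weight i) x

∣∏∣ : ∀ {k} (a : Vec ℤ k) → All (λ aᵢ → ∣ aᵢ ∣ ℕ.∣ ∏ ∣_∣ a) a
∣∏∣ []       = []
∣∏∣ (a ∷ as) = ℕ.m∣m*n _ ∷ All.map (λ aᵢ∣ → ℕ.∣n⇒∣m*n ∣ a ∣ aᵢ∣) (∣∏∣ as)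

∏-positive : ∀ {k} {a : Vec ℤ k} → All (_≢ 0ℤ) a → 1 ≤ ∏ ∣_∣ a
∏-positive []           = ℕ.≤-refl
∏-positive (a≢0 ∷ as≢0) = ℕ.*-mono-≤ (ℕ.n≢0⇒n>0 (a≢0 ∘ ℤ.∣i∣≡0⇒i≡0)) (∏-positive as≢0)

invertible-mod-1+∏ : ∀ {k} (a : Vec ℤ k) → All (Residues.Invertible (suc (∏ ∣_∣ a))) a
invertible-mod-1+∏ a = All.map (λ {b} b∣∏ → invert b (∣ᵤ⇒∣ b∣∏)) (∣∏∣ a)
  where
  eq : ∀ b c → b ℤ.* c ℤ.+ 1ℤ ≡ 1ℤ ℤ.* (1ℤ ℤ.+ c ℤ.* b)
  eq = ℤSolver.solve-∀
  invert : ∀ b → b ∣ + ∏ ∣_∣ a → Residues.Invertible (suc (∏ ∣_∣ a)) b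
  invert b (divides c ∏≡cb) = Residues.-1/≡ c
    (divides 1ℤ (trans (eq b c) (cong (λ x → 1ℤ ℤ.* (1ℤ ℤ.+ x)) (sym ∏≡cb))))

hyperplane? : ∀ {k} → Vec ℤ k → Vec ℤ k → ℕ
hyperplane? a x = ind (dot a x ℤ.≟ 0ℤ)

-- The hypothesis says, without subtraction, that at each solution the average of `h` over the
-- kernel shifts is at most K - 1. Summing `box-shift` over all shifts and exchanging the sums
-- transfers this to the box, because a kernel shift leaves the indicator of the hyperplane
-- unchanged.
∑ⱽ-kernelAverage : ∀ {j} {a : ℤ} {as : Vec ℤ (2 + j)} → All (_≢ 0ℤ) (a ∷ as) →
  ∀ p .{{_ : NonZero p}} (h : Vec ℤ (3 + j) → ℕ) {M K} → (∀ x → h x ≤ M) →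
  (∀ x → dot (a ∷ as) x ≡ 0ℤ →
    ∑ⱽ p (2 + j) (λ u → h (x ⊕ Residues.kernelVector p a as u)) + p ^ (2 + j) ≤ p ^ (2 + j) * K) →
  ∃ λ C → ∀ n → let N = box n (3 + j) (hyperplane? (a ∷ as)) in
    box n (3 + j) (λ x → hyperplane? (a ∷ as) x * h x) + N ≤ N * K + n ^ (1 + j) * C
∑ⱽ-kernelAverage {j} {a} {as} a≢0 p h {M} {K} h≤M average = C , bound-at
  where
  open Residues p
  d k : ℕ
  d = 2 + j
  k = 3 + j
  σ F : Vec ℤ k → ℕ
  σ = hyperplane? (a ∷ as)
  F x = σ x * h x
  C : ℕ
  C = ∑ⱽ p d (λ u → ‖ kernelVector a as u ‖ * M)
  F-hyperplane : OnHyperplane (a ∷ as) 0ℤ M F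
  F-hyperplane .OnHyperplane.F≤M x =
    ℕ.≤-trans (ℕ.*-mono-≤ (ind≤1 (dot (a ∷ as) x ℤ.≟ 0ℤ)) (h≤M x)) (ℕ.≤-reflexive (ℕ.*-identityˡ M))
  F-hyperplane .OnHyperplane.support x ≢0 =
    ind≢0 (dot (a ∷ as) x ℤ.≟ 0ℤ) λ σ≡0 → ≢0 (cong (_* h x) σ≡0)
  σ-kernel : ∀ x u → σ (x ⊕ kernelVector a as u) ≡ σ x
  σ-kernel x u = cong (λ t → ind (t ℤ.≟ 0ℤ)) (trans (dot-⊕ (a ∷ as) x (kernelVector a as u))
    (trans (cong (ℤ._+_ (dot (a ∷ as) x)) (dot-kernelVector a as u)) (ℤ.+-identityʳ _)))
  S : Vec ℤ k → ℕ
  S x = ∑ⱽ p d (λ u → h (x ⊕ kernelVector a as u))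
  average′ : ∀ x → σ x * S x + p ^ d * σ x ≤ p ^ d * K * σ x
  average′ x with dot (a ∷ as) x ℤ.≟ 0ℤ
  ... | yes sol = subst₂ _≤_ (eq (S x) (p ^ d)) (sym (ℕ.*-identityʳ _)) (average x sol)
    where
    eq : ∀ s q → s + q ≡ 1 * s + q * 1
    eq = ℕSolver.solve-∀
  ... | no _ = ℕ.≤-reflexive (eq (p ^ d) K)
    where
    eq : ∀ q K → 0 + q * 0 ≡ q * K * 0
    eq = ℕSolver.solve-∀
  module _ (n : ℕ) where
    ι : Vec (Fin n) k → Vec ℤ k
    ι = Vec.map ⟦_⟧
    N shifted : ℕ
    N = box n k σ
    shifted = ∑ⱽ p d (λ u → box n k (λ x → F (x ⊕ kernelVector a as u)))
    open ℕ.≤-Reasoning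
    p^d*box≤ : p ^ d * box n k F ≤ shifted + n ^ (1 + j) * C
    p^d*box≤ = begin
      p ^ d * box n k F                             ≡⟨ ∑ⱽ-const p d (box n k F) ⟨
      ∑ⱽ p d (λ _ → box n k F)                      ≤⟨ ∑ⱽ-mono p d (λ u → box-shift a≢0 F-hyperplane n (kernelVector a as u)) ⟩
      ∑ⱽ p d (λ u → box n k (λ x → F (x ⊕ kernelVector a as u)) + n ^ (1 + j) * (‖ kernelVector a as u ‖ * M))
        ≡⟨ ∑ⱽ-distrib-+ p d (λ u → box n k (λ x → F (x ⊕ kernelVector a as u))) (λ u → n ^ (1 + j) * (‖ kernelVector a as u ‖ * M)) ⟩
      shifted + ∑ⱽ p d (λ u → n ^ (1 + j) * (‖ kernelVector a as u ‖ * M))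
        ≡⟨ cong (_+_ shifted) (sym (*-distribˡ-∑ⱽ p d (n ^ (1 + j)) (λ u → ‖ kernelVector a as u ‖ * M))) ⟩
      shifted + n ^ (1 + j) * C                     ∎
    ∑ⱽ-F-kernel : ∀ x → ∑ⱽ p d (λ u → F (x ⊕ kernelVector a as u)) ≡ σ x * S x
    ∑ⱽ-F-kernel x = trans
      (∑ⱽ-cong p d {λ u → F (x ⊕ kernelVector a as u)} {λ u → σ x * h (x ⊕ kernelVector a as u)}
        λ u → cong (_* h (x ⊕ kernelVector a as u)) (σ-kernel x u))
      (sym (*-distribˡ-∑ⱽ p d (σ x) (λ u → h (x ⊕ kernelVector a as u))))
    shifted≤ : shifted + p ^ d * N ≤ p ^ d * K * N
    shifted≤ = begin
      shifted + p ^ d * N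
        ≡⟨ cong₂ _+_ (∑ⱽ-comm p d n k (λ u y → F (ι y ⊕ kernelVector a as u)))
                     (*-distribˡ-∑ⱽ n k (p ^ d) (λ y → σ (ι y))) ⟩
      ∑ⱽ n k (λ y → ∑ⱽ p d (λ u → F (ι y ⊕ kernelVector a as u))) + ∑ⱽ n k (λ y → p ^ d * σ (ι y))
        ≡⟨ cong (_+ ∑ⱽ n k (λ y → p ^ d * σ (ι y)))
             (∑ⱽ-cong n k {λ y → ∑ⱽ p d (λ u → F (ι y ⊕ kernelVector a as u))} {λ y → σ (ι y) * S (ι y)}
               λ y → ∑ⱽ-F-kernel (ι y)) ⟩
      ∑ⱽ n k (λ y → σ (ι y) * S (ι y)) + ∑ⱽ n k (λ y → p ^ d * σ (ι y))
        ≡⟨ ∑ⱽ-distrib-+ n k (λ y → σ (ι y) * S (ι y)) (λ y → p ^ d * σ (ι y)) ⟨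
      ∑ⱽ n k (λ y → σ (ι y) * S (ι y) + p ^ d * σ (ι y))
        ≤⟨ ∑ⱽ-mono n k {λ y → σ (ι y) * S (ι y) + p ^ d * σ (ι y)} {λ y → p ^ d * K * σ (ι y)} (λ y → average′ (ι y)) ⟩
      ∑ⱽ n k (λ y → p ^ d * K * σ (ι y))
        ≡⟨ *-distribˡ-∑ⱽ n k (p ^ d * K) (λ y → σ (ι y)) ⟨
      p ^ d * K * N ∎
    bound-at : box n k F + N ≤ N * K + n ^ (1 + j) * C
    bound-at = ℕ.*-cancelˡ-≤ (p ^ d) {{ℕ.m^n≢0 p d}} (begin
      p ^ d * (box n k F + N)                         ≡⟨ ℕ.*-distribˡ-+ (p ^ d) (box n k F) N ⟩
      p ^ d * box n k F + p ^ d * N                   ≤⟨ ℕ.+-monoˡ-≤ (p ^ d * N) p^d*box≤ ⟩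
      shifted + n ^ (1 + j) * C + p ^ d * N           ≡⟨ eq₁ shifted (n ^ (1 + j) * C) (p ^ d * N) ⟩
      shifted + p ^ d * N + n ^ (1 + j) * C           ≤⟨ ℕ.+-mono-≤ shifted≤ (ℕ.m≤n*m (n ^ (1 + j) * C) (p ^ d) {{ℕ.m^n≢0 p d}}) ⟩
      p ^ d * K * N + p ^ d * (n ^ (1 + j) * C)       ≡⟨ eq₂ (p ^ d) K N (n ^ (1 + j) * C) ⟩
      p ^ d * (N * K + n ^ (1 + j) * C)               ∎)
      where
      eq₁ : ∀ x y z → x + y + z ≡ x + z + y
      eq₁ = ℕSolver.solve-∀
      eq₂ : ∀ P K N e → P * K * N + P * e ≡ P * (N * K + e)
      eq₂ = ℕSolver.solve-∀

-- Colour weights and their average over solutions modulo p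

module Weights (q r : ℕ) where

  open Residues (suc q) public

  -- `g` takes the values `q` and -1, so amplitude times `g` is at least -2q; this `B` keeps every
  -- weight positive. `L` is a multiple of `B` because the amplitudes sum to zero.
  B L : ℕ
  B = 2 + 2 * q
  L = (3 + r) * B

  amplitude : Fin (3 + r) → ℤ
  amplitude zero                = 1ℤ
  amplitude (suc zero)          = 1ℤ
  amplitude (suc (suc zero))    = ℤ.- (+ 2)
  amplitude (suc (suc (suc _))) = 0ℤ

  -- The values of B + amplitude · g, tabulated to stay in ℕ.
  weight′ : ∀ {x} → Dec (+ suc q ∣ x) → Fin (3 + r) → ℕ
  weight′ (yes _) zero                = 2 + 3 * q
  weight′ (yes _) (suc zero)          = 2 + 3 * q
  weight′ (yes _) (suc (suc zero))    = 2
  weight′ (no  _) zero                = 1 + 2 * q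
  weight′ (no  _) (suc zero)          = 1 + 2 * q
  weight′ (no  _) (suc (suc zero))    = 4 + 2 * q
  weight′ _       (suc (suc (suc _))) = B

  weight : Fin (3 + r) → ℤ → ℕ
  weight i x = weight′ (+ suc q ∣? x) i

  private
    +B≡ : + B ≡ + 2 ℤ.+ + 2 ℤ.* + q
    +B≡ = cong (ℤ._+_ (+ 2)) (ℤ.pos-* 2 q)
    substB : ∀ c t {w} → w ≡ + 2 ℤ.+ + 2 ℤ.* + q ℤ.+ c ℤ.* t → w ≡ + B ℤ.+ c ℤ.* t
    substB c t eq = trans eq (cong (ℤ._+ c ℤ.* t) (sym +B≡))
    2+3q : + (2 + 3 * q) ≡ + B ℤ.+ 1ℤ ℤ.* (+ suc q ℤ.* 1ℤ ℤ.- 1ℤ)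
    2+3q = substB 1ℤ _ (trans (cong (ℤ._+_ (+ 2)) (ℤ.pos-* 3 q)) (eq (+ q)))
      where
      eq : ∀ q → + 2 ℤ.+ + 3 ℤ.* q ≡ + 2 ℤ.+ + 2 ℤ.* q ℤ.+ 1ℤ ℤ.* ((1ℤ ℤ.+ q) ℤ.* 1ℤ ℤ.- 1ℤ)
      eq = ℤSolver.solve-∀
    two : + 2 ≡ + B ℤ.+ ℤ.- (+ 2) ℤ.* (+ suc q ℤ.* 1ℤ ℤ.- 1ℤ)
    two = substB (ℤ.- (+ 2)) (+ suc q ℤ.* 1ℤ ℤ.- 1ℤ) (eq (+ q))
      where
      eq : ∀ q → + 2 ≡ + 2 ℤ.+ + 2 ℤ.* q ℤ.+ ℤ.- (+ 2) ℤ.* ((1ℤ ℤ.+ q) ℤ.* 1ℤ ℤ.- 1ℤ)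
      eq = ℤSolver.solve-∀
    1+2q : + (1 + 2 * q) ≡ + B ℤ.+ 1ℤ ℤ.* (+ suc q ℤ.* 0ℤ ℤ.- 1ℤ)
    1+2q = substB 1ℤ _ (trans (cong (ℤ._+_ 1ℤ) (ℤ.pos-* 2 q)) (eq (+ q)))
      where
      eq : ∀ q → 1ℤ ℤ.+ + 2 ℤ.* q ≡ + 2 ℤ.+ + 2 ℤ.* q ℤ.+ 1ℤ ℤ.* ((1ℤ ℤ.+ q) ℤ.* 0ℤ ℤ.- 1ℤ)
      eq = ℤSolver.solve-∀
    4+2q : + (4 + 2 * q) ≡ + B ℤ.+ ℤ.- (+ 2) ℤ.* (+ suc q ℤ.* 0ℤ ℤ.- 1ℤ)
    4+2q = substB (ℤ.- (+ 2)) _ (trans (cong (ℤ._+_ (+ 4)) (ℤ.pos-* 2 q)) (eq (+ q)))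
      where
      eq : ∀ q → + 4 ℤ.+ + 2 ℤ.* q ≡ + 2 ℤ.+ + 2 ℤ.* q ℤ.+ ℤ.- (+ 2) ℤ.* ((1ℤ ℤ.+ q) ℤ.* 0ℤ ℤ.- 1ℤ)
      eq = ℤSolver.solve-∀

  weight≡ : ∀ i x → + weight i x ≡ + B ℤ.+ amplitude i ℤ.* g x
  weight≡ i x with + suc q ∣? x
  weight≡ zero x                | yes _ = 2+3q
  weight≡ (suc zero) x          | yes _ = 2+3q
  weight≡ (suc (suc zero)) x    | yes _ = two
  weight≡ (suc (suc (suc i))) x | yes _ = sym (ℤ.+-identityʳ (+ B))
  weight≡ zero x                | no _  = 1+2q
  weight≡ (suc zero) x          | no _  = 1+2q
  weight≡ (suc (suc zero)) x    | no _  = 4+2q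
  weight≡ (suc (suc (suc i))) x | no _  = sym (ℤ.+-identityʳ (+ B))

  ∑-weight : ∀ x → ∑[ i < 3 + r ] weight i x ≡ L
  ∑-weight x with + suc q ∣? x
  ... | yes _ = trans (cong (λ t → 2 + 3 * q + (2 + 3 * q + (2 + t))) (∑-const r B)) (eq q r)
    where
    eq : ∀ q r → 2 + 3 * q + (2 + 3 * q + (2 + r * (2 + 2 * q))) ≡ (3 + r) * (2 + 2 * q)
    eq = ℕSolver.solve-∀
  ... | no  _ = trans (cong (λ t → 1 + 2 * q + (1 + 2 * q + (4 + 2 * q + t))) (∑-const r B)) (eq q r)
    where
    eq : ∀ q r → 1 + 2 * q + (1 + 2 * q + (4 + 2 * q + r * (2 + 2 * q))) ≡ (3 + r) * (2 + 2 * q)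
    eq = ℕSolver.solve-∀

  mass : ∀ {k} → Vec ℤ k → ℕ
  mass = weightedMass weight

  mass≤ : ∀ {k} (x : Vec ℤ k) → mass x ≤ (3 + r) * L ^ k
  mass≤ {k} x = ℕ.≤-trans
    (∑-mono λ (i : Fin (3 + r)) → ∏≤^ (weight i) (λ y → ℕ.≤-trans (term≤∑ (λ i → weight i y) i) (ℕ.≤-reflexive (∑-weight y))) x)
    (ℕ.≤-reflexive (∑-const (3 + r) (L ^ k)))

  -- The hypothesis on e says that suc d is odd and 2 ^ suc d = 2 * e.
  mass-average : ∀ {d a} {as : Vec ℤ d} → Invertible a → All Invertible as → 1 ≤ q →
    ∀ e → 2 ≤ e → (ℤ.- (+ 2)) ℤ.^ suc d ≡ ℤ.- (+ (2 * e)) →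
    ∀ x → dot (a ∷ as) x ≡ 0ℤ →
    ∑ⱽ (suc q) d (λ u → mass (x ⊕ kernelVector a as u)) + suc q ^ d ≤ suc q ^ d * ((3 + r) * B ^ suc d)
  -- The colour of amplitude -2 contributes P (X - 2 e q); adding `P * (2 * e * q)` to both sides
  -- avoids the subtraction.
  mass-average {d} {a} {as} a⁻¹ as⁻¹ 1≤q e 2≤e power x sol = ℕ.+-cancelʳ-≤ (P * (2 * e * q)) _ _ (begin
    ∑ⱽ p d (λ u → mass (x ⊕ kernelVector a as u)) + P + P * (2 * e * q)
      ≡⟨ cong (λ t → t + P + P * (2 * e * q)) (sym (∑-∑ⱽ-comm (3 + r) p d (λ i u → ∏ (weight i) (x ⊕ kernelVector a as u)))) ⟩
    (T zero + (T (suc zero) + (T (suc (suc zero)) + ∑[ i < r ] T (suc (suc (suc i)))))) + P + P * (2 * e * q)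
      ≡⟨ cong (λ t → t + P + P * (2 * e * q)) (cong₂ (λ t s → t + s) T₀ (cong₂ _+_ T₁ (cong (_+_ (T (suc (suc zero)))) (trans (sum-cong-≗ T₃) (∑-const r (P * X)))))) ⟩
    (P * (X + q) + (P * (X + q) + (T (suc (suc zero)) + r * (P * X)))) + P + P * (2 * e * q)
      ≡⟨ eq₁ P X q (T (suc (suc zero))) r (P * (2 * e * q)) ⟩
    (T (suc (suc zero)) + P * (2 * e * q)) + (P * (X + q) + (P * (X + q) + r * (P * X))) + P
      ≡⟨ cong (λ t → t + (P * (X + q) + (P * (X + q) + r * (P * X))) + P) T₂ ⟩
    P * X + (P * (X + q) + (P * (X + q) + r * (P * X))) + P
      ≡⟨ eq₂ P X q r ⟩
    P * ((3 + r) * X) + P * (2 * q + 1)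
      ≤⟨ ℕ.+-monoʳ-≤ (P * ((3 + r) * X)) (ℕ.*-monoʳ-≤ P 2q+1≤2eq) ⟩
    P * ((3 + r) * X) + P * (2 * e * q) ∎)
    where
    open ℕ.≤-Reasoning
    p P X : ℕ
    p = suc q
    P = p ^ d
    X = B ^ suc d
    T : Fin (3 + r) → ℕ
    T i = ∑ⱽ p d (λ u → ∏ (weight i) (x ⊕ kernelVector a as u))
    pos-^ : ∀ m k → (+ m) ℤ.^ k ≡ + (m ^ k)
    pos-^ m zero    = refl
    pos-^ m (suc k) = trans (cong (ℤ._*_ (+ m)) (pos-^ m k)) (sym (ℤ.pos-* m _))
    g₀≡q : g (dot (a ∷ as) x) ≡ + q
    g₀≡q = trans (cong (λ s → + p ℤ.* + s ℤ.- 1ℤ) (ind-true (+ p ∣? _) (divides 0ℤ sol))) (eq (+ q))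
      where
      eq : ∀ q → (1ℤ ℤ.+ q) ℤ.* 1ℤ ℤ.- 1ℤ ≡ q
      eq = ℤSolver.solve-∀
    T≡ : ∀ i {c} → amplitude i ℤ.^ suc d ≡ c → + T i ≡ + P ℤ.* (+ X ℤ.+ c ℤ.* + q)
    T≡ i refl = trans (∑-kernelVector (weight i) (+ B) (amplitude i) (weight≡ i) a⁻¹ as⁻¹ x)
      (cong₂ ℤ._*_ (pos-^ p d) (cong₂ (λ s t → s ℤ.+ amplitude i ℤ.^ suc d ℤ.* t) (pos-^ B (suc d)) g₀≡q))
    T₀₁ : ∀ i → amplitude i ≡ 1ℤ → T i ≡ P * (X + q)
    T₀₁ i eq = ℤ.+-injective (trans (T≡ i (trans (cong (ℤ._^ suc d) eq) (ℤ.^-zeroˡ (suc d))))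
      (trans (cong (λ t → + P ℤ.* (+ X ℤ.+ t)) (ℤ.*-identityˡ (+ q))) (sym (ℤ.pos-* P (X + q)))))
    T₀ : T zero ≡ P * (X + q)
    T₀ = T₀₁ zero refl
    T₁ : T (suc zero) ≡ P * (X + q)
    T₁ = T₀₁ (suc zero) refl
    T₂ : T (suc (suc zero)) + P * (2 * e * q) ≡ P * X
    T₂ = ℤ.+-injective (trans (cong₂ ℤ._+_ (T≡ (suc (suc zero)) power) (trans (ℤ.pos-* P _) (cong (ℤ._*_ (+ P)) (ℤ.pos-* (2 * e) q))))
      (trans (eq (+ P) (+ X) (+ (2 * e)) (+ q)) (sym (ℤ.pos-* P X))))
      where
      eq : ∀ P X E q → P ℤ.* (X ℤ.+ ℤ.- E ℤ.* q) ℤ.+ P ℤ.* (E ℤ.* q) ≡ P ℤ.* X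
      eq = ℤSolver.solve-∀
    T₃ : ∀ i → T (suc (suc (suc i))) ≡ P * X
    T₃ i = ℤ.+-injective (trans (T≡ (suc (suc (suc i))) refl)
      (trans (cong (ℤ._*_ (+ P)) (ℤ.+-identityʳ (+ X))) (sym (ℤ.pos-* P X))))
    -- The two colours of amplitude 1 gain `q` each and the third loses `2 * e * q`; the net loss
    -- has to cover the 1 claimed per shift.
    2q+1≤2eq : 2 * q + 1 ≤ 2 * e * q
    2q+1≤2eq = begin
      2 * q + 1         ≤⟨ ℕ.+-monoʳ-≤ (2 * q) (ℕ.≤-trans 1≤q (ℕ.m≤m+n q _)) ⟩
      2 * q + 2 * q     ≡⟨ eq q ⟩
      2 * 2 * q         ≤⟨ ℕ.*-monoˡ-≤ q (ℕ.*-monoʳ-≤ 2 2≤e) ⟩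
      2 * e * q         ∎
      where
      eq : ∀ q → 2 * q + 2 * q ≡ 2 * 2 * q
      eq = ℕSolver.solve-∀
    eq₁ : ∀ P X q T r E → (P * (X + q) + (P * (X + q) + (T + r * (P * X)))) + P + E
          ≡ (T + E) + (P * (X + q) + (P * (X + q) + r * (P * X))) + P
    eq₁ = ℕSolver.solve-∀
    eq₂ : ∀ P X q r → P * X + (P * (X + q) + (P * (X + q) + r * (P * X))) + P ≡ P * ((3 + r) * X) + P * (2 * q + 1)
    eq₂ = ℕSolver.solve-∀

-- Solutions with a repeated coordinate, and derandomisation

occ : ∀ {n k} → Fin n → Vec (Fin n) k → ℕ
occ x []      = 0
occ x (y ∷ t) = ind (x Fin.≟ y) + occ x t

-- Counts coinciding pairs of positions, so it vanishes exactly on tuples with distinct entries.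
-- Being additive, it can be bounded one entry at a time, unlike the indicator of a repetition.
dup : ∀ {n k} → Vec (Fin n) k → ℕ
dup []      = 0
dup (x ∷ t) = occ x t + dup t

∑-ind≟ : ∀ {n} (x : Fin n) → ∑[ y < n ] ind (x Fin.≟ y) ≤ 1
∑-ind≟ {n} x = ∑-support≤1 (λ (y : Fin n) → ind (x Fin.≟ y)) (λ y → ind≤1 (x Fin.≟ y))
  λ i j p q → trans (sym (ind≢0 (x Fin.≟ i) p)) (ind≢0 (x Fin.≟ j) q)

∑-* : ∀ {n} (f : Fin n → ℕ) c → sum f ≤ 1 → ∑[ i < n ] (f i * c) ≤ c
∑-* f c ∑f≤1 = ℕ.≤-trans (ℕ.≤-reflexive (sym (*-distribʳ-sum c f)))
  (ℕ.≤-trans (ℕ.*-monoˡ-≤ c ∑f≤1) (ℕ.≤-reflexive (ℕ.*-identityˡ c)))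

∑≤n* : ∀ {n} {f : Fin n → ℕ} {M} → (∀ i → f i ≤ M) → sum f ≤ n * M
∑≤n* {n} {M = M} f≤M = ℕ.≤-trans (∑-mono f≤M) (ℕ.≤-reflexive (∑-const n M))

∑ⱽ-occ : ∀ n e (x : Fin n) → ∑ⱽ n (suc e) (occ x) ≤ n ^ e * suc e
∑ⱽ-occ n e x = begin
  ∑[ y < n ] ∑ⱽ n e (λ t → ind (x Fin.≟ y) + occ x t)
    ≡⟨ sum-cong-≗ (λ (y : Fin n) → trans (∑ⱽ-distrib-+ n e (λ _ → ind (x Fin.≟ y)) (occ x))
         (cong (_+ ∑ⱽ n e (occ x)) (trans (∑ⱽ-const n e (ind (x Fin.≟ y))) (ℕ.*-comm (n ^ e) _)))) ⟩
  ∑[ y < n ] (ind (x Fin.≟ y) * n ^ e + ∑ⱽ n e (occ x))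
    ≡⟨ ∑-distrib-+ (λ (y : Fin n) → ind (x Fin.≟ y) * n ^ e) (λ _ → ∑ⱽ n e (occ x)) ⟩
  ∑[ y < n ] (ind (x Fin.≟ y) * n ^ e) + ∑[ y < n ] ∑ⱽ n e (occ x)
    ≤⟨ ℕ.+-mono-≤ (∑-* (λ (y : Fin n) → ind (x Fin.≟ y)) (n ^ e) (∑-ind≟ x)) (tail-bound e) ⟩
  n ^ e + n ^ e * e
    ≡⟨ ℕ.*-suc (n ^ e) e ⟨
  n ^ e * suc e ∎
  where
  open ℕ.≤-Reasoning
  tail-bound : ∀ e → ∑[ y < n ] ∑ⱽ n e (occ x) ≤ n ^ e * e
  tail-bound zero    = ℕ.≤-reflexive (∑-zero λ (_ : Fin n) → refl)
  tail-bound (suc e) = ℕ.≤-trans (∑≤n* λ (_ : Fin n) → ∑ⱽ-occ n e x) (ℕ.≤-reflexive (sym (ℕ.*-assoc n (n ^ e) (suc e))))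

∑ⱽ-dup : ∀ e → ∃ λ C → ∀ n → ∑ⱽ n (suc e) dup ≤ n ^ e * C
∑ⱽ-dup zero    = 0 , λ n → ℕ.≤-reflexive (∑-zero λ (_ : Fin n) → refl)
∑ⱽ-dup (suc e) with C , dup≤ ← ∑ⱽ-dup e = suc e + C , λ n → begin
  ∑[ x < n ] ∑ⱽ n (suc e) (λ t → occ x t + dup t)
    ≤⟨ ∑≤n* (λ (x : Fin n) → ℕ.≤-trans (ℕ.≤-reflexive (∑ⱽ-distrib-+ n (suc e) (occ x) dup)) (ℕ.+-mono-≤ (∑ⱽ-occ n e x) (dup≤ n))) ⟩
  n * (n ^ e * suc e + n ^ e * C)
    ≡⟨ eq n (n ^ e) (suc e) C ⟩
  n ^ suc e * (suc e + C) ∎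
  where
  open ℕ.≤-Reasoning
  eq : ∀ n N e C → n * (N * e + N * C) ≡ n * N * (e + C)
  eq = ℕSolver.solve-∀

module _ {k a s F} {as : Vec ℤ k} (a≢0 : a ≢ 0ℤ) (F-hyperplane : OnHyperplane (a ∷ as) s 1 F) where

  ∑∑ⱽ-hyperplane : ∀ n (G : Vec (Fin n) k → ℕ) →
    ∑[ y < n ] ∑ⱽ n k (λ t → F (⟦ y ⟧ ∷ Vec.map ⟦_⟧ t) * G t) ≤ ∑ⱽ n k G
  ∑∑ⱽ-hyperplane n G = ℕ.≤-trans
    (ℕ.≤-reflexive (∑-∑ⱽ-comm n n k (λ y t → F (⟦ y ⟧ ∷ Vec.map ⟦_⟧ t) * G t)))
    (∑ⱽ-mono n k λ t → ∑-* (λ (y : Fin n) → F (⟦ y ⟧ ∷ Vec.map ⟦_⟧ t)) (G t) (∑-hyperplane a≢0 F-hyperplane n (Vec.map ⟦_⟧ t)))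

-- Either `x` is the first entry, and the others lie on a hyperplane, or it occurs later, and the
-- first entry is determined by the others.
∑ⱽ-occ-hyperplane : ∀ {j s F} {a : Vec ℤ (2 + j)} → All (_≢ 0ℤ) a → OnHyperplane a s 1 F →
  ∀ n (x : Fin n) → ∑ⱽ n (2 + j) (λ t → F (Vec.map ⟦_⟧ t) * occ x t) ≤ n ^ j * (2 + j)
∑ⱽ-occ-hyperplane {j} {F = F} (a≢0 ∷ as≢0) h n x = begin
  ∑[ y < n ] ∑ⱽ n (1 + j) (λ t → F (⟦ y ⟧ ∷ ι t) * (ind (x Fin.≟ y) + occ x t))
    ≡⟨ sum-cong-≗ (λ (y : Fin n) → trans
         (∑ⱽ-cong n (1 + j) {λ t → F (⟦ y ⟧ ∷ ι t) * (ind (x Fin.≟ y) + occ x t)}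
            {λ t → ind (x Fin.≟ y) * F (⟦ y ⟧ ∷ ι t) + F (⟦ y ⟧ ∷ ι t) * occ x t}
            λ t → eq (F (⟦ y ⟧ ∷ ι t)) (ind (x Fin.≟ y)) (occ x t))
         (∑ⱽ-distrib-+ n (1 + j) (λ t → ind (x Fin.≟ y) * F (⟦ y ⟧ ∷ ι t)) (λ t → F (⟦ y ⟧ ∷ ι t) * occ x t))) ⟩
  ∑[ y < n ] (here y + there y)
    ≡⟨ ∑-distrib-+ here there ⟩
  sum here + sum there
    ≤⟨ ℕ.+-mono-≤ here≤ (ℕ.≤-trans (∑∑ⱽ-hyperplane a≢0 h n (occ x)) (∑ⱽ-occ n j x)) ⟩
  n ^ j + n ^ j * (1 + j)
    ≡⟨ ℕ.*-suc (n ^ j) (1 + j) ⟨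
  n ^ j * (2 + j) ∎
  where
  open ℕ.≤-Reasoning
  ι : ∀ {k} → Vec (Fin n) k → Vec ℤ k
  ι = Vec.map ⟦_⟧
  here there : Fin n → ℕ
  here y = ∑ⱽ n (1 + j) (λ t → ind (x Fin.≟ y) * F (⟦ y ⟧ ∷ ι t))
  there y = ∑ⱽ n (1 + j) (λ t → F (⟦ y ⟧ ∷ ι t) * occ x t)
  eq : ∀ f i o → f * (i + o) ≡ i * f + f * o
  eq = ℕSolver.solve-∀
  here≤ : sum here ≤ n ^ j
  here≤ = ℕ.≤-trans
    (∑-mono λ (y : Fin n) → ℕ.≤-trans
      (ℕ.≤-reflexive (sym (*-distribˡ-∑ⱽ n (1 + j) (ind (x Fin.≟ y)) (λ t → F (⟦ y ⟧ ∷ ι t)))))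
      (ℕ.*-monoʳ-≤ (ind (x Fin.≟ y)) (ℕ.≤-trans (box-hyperplane as≢0 (slice h ⟦ y ⟧) n) (ℕ.≤-reflexive (ℕ.*-identityʳ (n ^ j))))))
    (∑-* (λ (y : Fin n) → ind (x Fin.≟ y)) (n ^ j) (∑-ind≟ x))

-- Setting two entries equal could cancel their coefficients, so the equation is always solved for
-- an entry outside the coinciding pair; with three or more coordinates there is one.
∑ⱽ-dup-hyperplane : ∀ j → ∃ λ C → ∀ {s F} {a : Vec ℤ (3 + j)} → All (_≢ 0ℤ) a → OnHyperplane a s 1 F →
  ∀ n → ∑ⱽ n (3 + j) (λ x → F (Vec.map ⟦_⟧ x) * dup x) ≤ n ^ (1 + j) * C
∑ⱽ-dup-hyperplane j with C , dup≤ ← ∑ⱽ-dup (1 + j) = 2 + j + C , bounded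
  where
  bounded : ∀ {s F} {a : Vec ℤ (3 + j)} → All (_≢ 0ℤ) a → OnHyperplane a s 1 F →
    ∀ n → ∑ⱽ n (3 + j) (λ x → F (Vec.map ⟦_⟧ x) * dup x) ≤ n ^ (1 + j) * (2 + j + C)
  bounded {F = F} (a≢0 ∷ as≢0) h n = begin
    ∑[ x < n ] ∑ⱽ n (2 + j) (λ t → F (⟦ x ⟧ ∷ ι t) * (occ x t + dup t))
      ≡⟨ sum-cong-≗ (λ (x : Fin n) → trans
           (∑ⱽ-cong n (2 + j) {λ t → F (⟦ x ⟧ ∷ ι t) * (occ x t + dup t)}
              {λ t → F (⟦ x ⟧ ∷ ι t) * occ x t + F (⟦ x ⟧ ∷ ι t) * dup t}
              λ t → ℕ.*-distribˡ-+ (F (⟦ x ⟧ ∷ ι t)) (occ x t) (dup t))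
           (∑ⱽ-distrib-+ n (2 + j) (λ t → F (⟦ x ⟧ ∷ ι t) * occ x t) (λ t → F (⟦ x ⟧ ∷ ι t) * dup t))) ⟩
    ∑[ x < n ] (here x + there x)
      ≡⟨ ∑-distrib-+ here there ⟩
    sum here + sum there
      ≤⟨ ℕ.+-mono-≤ (∑≤n* λ x → ∑ⱽ-occ-hyperplane as≢0 (slice h ⟦ x ⟧) n x)
                    (ℕ.≤-trans (∑∑ⱽ-hyperplane a≢0 h n dup) (dup≤ n)) ⟩
    n * (n ^ j * (2 + j)) + n ^ (1 + j) * C
      ≡⟨ eq n (n ^ j) (2 + j) C ⟩
    n ^ (1 + j) * (2 + j + C) ∎
    where
    open ℕ.≤-Reasoning
    ι : ∀ {k} → Vec (Fin n) k → Vec ℤ k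
    ι = Vec.map ⟦_⟧
    here there : Fin n → ℕ
    here x = ∑ⱽ n (2 + j) (λ t → F (⟦ x ⟧ ∷ ι t) * occ x t)
    there x = ∑ⱽ n (2 + j) (λ t → F (⟦ x ⟧ ∷ ι t) * dup t)
    eq : ∀ n N e C → n * (N * e) + n * N * C ≡ n * N * (e + C)
    eq = ℕSolver.solve-∀

-- Derandomisation by conditional expectations

∑-ind≟-* : ∀ {r} (f : Fin r → ℕ) i → ∑[ j < r ] (f j * ind (j Fin.≟ i)) ≡ f i
∑-ind≟-* {suc r} f i = begin
  ∑[ j < suc r ] F j                              ≡⟨ sum-remove {i = i} F ⟩
  F i + ∑[ j < r ] F (Fin.punchIn i j)            ≡⟨ cong₂ _+_ (cong (f i *_) (ind-true (i Fin.≟ i) refl))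
                                                       (∑-zero λ j → trans (cong (f (Fin.punchIn i j) *_) (ind-false (_ Fin.≟ i) (Fin.punchInᵢ≢i i j))) (ℕ.*-zeroʳ (f (Fin.punchIn i j)))) ⟩
  f i * 1 + 0                                     ≡⟨ trans (ℕ.+-identityʳ _) (ℕ.*-identityʳ (f i)) ⟩
  f i                                             ∎
  where
  open ≡-Reasoning
  F : Fin (suc r) → ℕ
  F j = f j * ind (j Fin.≟ i)

below-average : ∀ {r} L (w v : Fin r → ℕ) V → sum w ≡ suc L → ∑[ i < r ] (w i * v i) ≡ suc L * V → ∃ λ i → v i ≤ V
below-average L w v V ∑w ∑wv with Fin.any? (λ i → v i ℕ.≤? V)
... | yes (i , vᵢ≤V) = i , vᵢ≤V
... | no ∄ = contradiction (begin
  suc L * suc V                ≡⟨ cong (_* suc V) ∑w ⟨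
  sum w * suc V                ≡⟨ *-distribʳ-sum (suc V) w ⟩
  sum (λ i → w i * suc V)      ≤⟨ ∑-mono (λ i → ℕ.*-monoʳ-≤ (w i) (ℕ.≰⇒> (λ vᵢ≤V → ∄ (i , vᵢ≤V)))) ⟩
  sum (λ i → w i * v i)        ≡⟨ ∑wv ⟩
  suc L * V                    ∎) (ℕ.<⇒≱ (ℕ.*-monoʳ-< (suc L) ℕ.≤-refl))
  where open ℕ.≤-Reasoning

module Derandomisation {r : ℕ} (L-1 : ℕ) where

  L : ℕ
  L = suc L-1

  -- An unnormalised colour distribution at one element of [n]; `vertex j` is the deterministic one.
  Row : Set
  Row = Fin r → ℕ

  vertex : Fin r → Row
  vertex j i = L * ind (j Fin.≟ i)

  Balanced : ∀ {n} → Vec Row n → Set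
  Balanced = All (λ ρ → sum ρ ≡ L)

  vertex-balanced : ∀ j → sum (vertex j) ≡ L
  vertex-balanced j = trans
    (sum-cong-≗ λ i → cong (L *_) (ind-⇔ (j Fin.≟ i) (i Fin.≟ j) sym sym)) (∑-ind≟-* (λ _ → L) j)

  -- Affinity in each row, in mean value form: drawing the colour of `y` from its row leaves the
  -- expectation of `G` unchanged.
  Multiaffine : ∀ {n} → (Vec Row n → ℕ) → Set
  Multiaffine {n} G = ∀ w → Balanced w → ∀ (y : Fin n) →
    ∑[ j < r ] (lookup w y j * G (w [ y ]≔ vertex j)) ≡ L * G w

  -- The method of conditional expectations.
  derandomise : ∀ {n} (G : Vec Row n → ℕ) → Multiaffine G → ∀ w → Balanced w →
                ∃ λ c → G (Vec.map vertex c) ≤ G w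
  derandomise G affine []      []        = [] , ℕ.≤-refl
  derandomise G affine (ρ ∷ w) (ρ-balanced ∷ w-balanced)
    with j , Gj≤ ← below-average L-1 ρ (λ j → G (vertex j ∷ w)) (G (ρ ∷ w)) ρ-balanced
                     (affine (ρ ∷ w) (ρ-balanced ∷ w-balanced) zero)
    with c , Gc≤ ← derandomise (λ w → G (vertex j ∷ w))
                     (λ w b y → affine (vertex j ∷ w) (vertex-balanced j ∷ b) (suc y)) w w-balanced
    = j ∷ c , ℕ.≤-trans Gc≤ Gj≤

  rowProduct : ∀ {n k} → Vec Row n → Fin r → Vec (Fin n) k → ℕ
  rowProduct w i []      = 1
  rowProduct w i (x ∷ t) = lookup w x i * rowProduct w i t

  rowProduct-update : ∀ {n k} (w : Vec Row n) y ρ i (x : Vec (Fin n) k) → occ y x ≡ 0 →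
                      rowProduct (w [ y ]≔ ρ) i x ≡ rowProduct w i x
  rowProduct-update w y ρ i []      occ≡0 = refl
  rowProduct-update w y ρ i (x ∷ t) occ≡0 with y Fin.≟ x
  ... | no y≢x = cong₂ _*_ (cong (λ ρ → ρ i) (lookup∘update′ (y≢x ∘ sym) w ρ)) (rowProduct-update w y ρ i t occ≡0)

  -- With distinct entries the row of `y` enters at most one factor; a repeated entry could make the
  -- product quadratic in it.
  rowProduct-affine : ∀ {n k} (w : Vec Row n) → Balanced w → ∀ y i (x : Vec (Fin n) k) → dup x ≡ 0 →
    ∑[ j < r ] (lookup w y j * rowProduct (w [ y ]≔ vertex j) i x) ≡ L * rowProduct w i x
  -- Reached when no factor involves `y`: its row then contributes only its sum `L`.
  rowProduct-affine w balanced y i [] _ =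
    trans (sum-cong-≗ λ j → ℕ.*-identityʳ (lookup w y j)) (trans (All.lookup⁺ balanced y) (sym (ℕ.*-identityʳ L)))
  rowProduct-affine w balanced y i (x ∷ t) dup≡0 with y Fin.≟ x
  ... | yes refl = begin
    ∑[ j < r ] (lookup w x j * (lookup (w [ x ]≔ vertex j) x i * rowProduct (w [ x ]≔ vertex j) i t))
      ≡⟨ sum-cong-≗ (λ j → trans (cong (lookup w x j *_) (cong₂ _*_ (cong (λ ρ → ρ i) (lookup∘update x w (vertex j)))
           (rowProduct-update w x (vertex j) i t (ℕ.m+n≡0⇒m≡0 _ dup≡0))))
           (eq₁ (lookup w x j) L (ind (j Fin.≟ i)) (rowProduct w i t))) ⟩
    ∑[ j < r ] (lookup w x j * ind (j Fin.≟ i) * (L * rowProduct w i t))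
      ≡⟨ *-distribʳ-sum (L * rowProduct w i t) (λ j → lookup w x j * ind (j Fin.≟ i)) ⟨
    ∑[ j < r ] (lookup w x j * ind (j Fin.≟ i)) * (L * rowProduct w i t)
      ≡⟨ cong (_* (L * rowProduct w i t)) (∑-ind≟-* (lookup w x) i) ⟩
    lookup w x i * (L * rowProduct w i t)
      ≡⟨ eq₂ (lookup w x i) L (rowProduct w i t) ⟩
    L * (lookup w x i * rowProduct w i t) ∎
    where
    open ≡-Reasoning
    eq₁ : ∀ w L e t → w * (L * e * t) ≡ w * e * (L * t)
    eq₁ = ℕSolver.solve-∀
    eq₂ : ∀ w L t → w * (L * t) ≡ L * (w * t)
    eq₂ = ℕSolver.solve-∀
  ... | no y≢x = begin
    ∑[ j < r ] (lookup w y j * (lookup (w [ y ]≔ vertex j) x i * rowProduct (w [ y ]≔ vertex j) i t))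
      ≡⟨ sum-cong-≗ (λ j → trans (cong (λ s → lookup w y j * (s * rowProduct (w [ y ]≔ vertex j) i t))
           (cong (λ ρ → ρ i) (lookup∘update′ (y≢x ∘ sym) w (vertex j))))
           (eq (lookup w y j) (lookup w x i) (rowProduct (w [ y ]≔ vertex j) i t))) ⟩
    ∑[ j < r ] (lookup w x i * (lookup w y j * rowProduct (w [ y ]≔ vertex j) i t))
      ≡⟨ *-distribˡ-sum (lookup w x i) (λ j → lookup w y j * rowProduct (w [ y ]≔ vertex j) i t) ⟨
    lookup w x i * ∑[ j < r ] (lookup w y j * rowProduct (w [ y ]≔ vertex j) i t)
      ≡⟨ cong (lookup w x i *_) (rowProduct-affine w balanced y i t (ℕ.m+n≡0⇒n≡0 (occ x t) dup≡0)) ⟩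
    lookup w x i * (L * rowProduct w i t)
      ≡⟨ eq (lookup w x i) L (rowProduct w i t) ⟩
    L * (lookup w x i * rowProduct w i t) ∎
    where
    open ≡-Reasoning
    eq : ∀ u v t → u * (v * t) ≡ v * (u * t)
    eq = ℕSolver.solve-∀

  rowMass : ∀ {n k} → Vec Row n → Vec (Fin n) k → ℕ
  rowMass w x = ∑[ i < r ] rowProduct w i x

  rowMass-affine : ∀ {n k} (w : Vec Row n) → Balanced w → ∀ y (x : Vec (Fin n) k) → dup x ≡ 0 →
    ∑[ j < r ] (lookup w y j * rowMass (w [ y ]≔ vertex j) x) ≡ L * rowMass w x
  rowMass-affine w balanced y x dup≡0 = begin
    ∑[ j < r ] (lookup w y j * rowMass (w [ y ]≔ vertex j) x)
      ≡⟨ sum-cong-≗ (λ j → *-distribˡ-sum (lookup w y j) (λ i → rowProduct (w [ y ]≔ vertex j) i x)) ⟩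
    ∑[ j < r ] ∑[ i < r ] (lookup w y j * rowProduct (w [ y ]≔ vertex j) i x)
      ≡⟨ ∑-comm (λ j i → lookup w y j * rowProduct (w [ y ]≔ vertex j) i x) ⟩
    ∑[ i < r ] ∑[ j < r ] (lookup w y j * rowProduct (w [ y ]≔ vertex j) i x)
      ≡⟨ sum-cong-≗ (λ i → rowProduct-affine w balanced y i x dup≡0) ⟩
    ∑[ i < r ] (L * rowProduct w i x)
      ≡⟨ *-distribˡ-sum L (λ i → rowProduct w i x) ⟨
    L * rowMass w x ∎
    where open ≡-Reasoning

  ∑ⱽ-rowMass-affine : ∀ n k (τ : Vec (Fin n) k → ℕ) → (∀ x → τ x ≢ 0 → dup x ≡ 0) →
    Multiaffine (λ w → ∑ⱽ n k (λ x → τ x * rowMass w x))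
  ∑ⱽ-rowMass-affine n k τ τ-injective w balanced y = begin
    ∑[ j < r ] (lookup w y j * ∑ⱽ n k (λ x → τ x * rowMass (w [ y ]≔ vertex j) x))
      ≡⟨ sum-cong-≗ (λ j → *-distribˡ-∑ⱽ n k (lookup w y j) (λ x → τ x * rowMass (w [ y ]≔ vertex j) x)) ⟩
    ∑[ j < r ] ∑ⱽ n k (λ x → lookup w y j * (τ x * rowMass (w [ y ]≔ vertex j) x))
      ≡⟨ ∑-∑ⱽ-comm r n k (λ j x → lookup w y j * (τ x * rowMass (w [ y ]≔ vertex j) x)) ⟩
    ∑ⱽ n k (λ x → ∑[ j < r ] (lookup w y j * (τ x * rowMass (w [ y ]≔ vertex j) x)))
      ≡⟨ ∑ⱽ-cong n k {λ x → ∑[ j < r ] (lookup w y j * (τ x * rowMass (w [ y ]≔ vertex j) x))} {λ x → L * (τ x * rowMass w x)} pointwise ⟩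
    ∑ⱽ n k (λ x → L * (τ x * rowMass w x))
      ≡⟨ *-distribˡ-∑ⱽ n k L (λ x → τ x * rowMass w x) ⟨
    L * ∑ⱽ n k (λ x → τ x * rowMass w x) ∎
    where
    open ≡-Reasoning
    eq : ∀ u v t → u * (v * t) ≡ v * (u * t)
    eq = ℕSolver.solve-∀
    pointwise : ∀ x → ∑[ j < r ] (lookup w y j * (τ x * rowMass (w [ y ]≔ vertex j) x)) ≡ L * (τ x * rowMass w x)
    pointwise x with τ x ℕ.≟ 0
    ... | yes τ≡0 rewrite τ≡0 = trans (∑-zero λ j → ℕ.*-zeroʳ (lookup w y j)) (sym (ℕ.*-zeroʳ L))
    ... | no τ≢0 = begin
      ∑[ j < r ] (lookup w y j * (τ x * rowMass (w [ y ]≔ vertex j) x))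
        ≡⟨ sum-cong-≗ (λ j → eq (lookup w y j) (τ x) (rowMass (w [ y ]≔ vertex j) x)) ⟩
      ∑[ j < r ] (τ x * (lookup w y j * rowMass (w [ y ]≔ vertex j) x))
        ≡⟨ *-distribˡ-sum (τ x) (λ j → lookup w y j * rowMass (w [ y ]≔ vertex j) x) ⟨
      τ x * ∑[ j < r ] (lookup w y j * rowMass (w [ y ]≔ vertex j) x)
        ≡⟨ cong (τ x *_) (rowMass-affine w balanced y x (τ-injective x τ≢0)) ⟩
      τ x * (L * rowMass w x)
        ≡⟨ eq (τ x) L (rowMass w x) ⟩
      L * (τ x * rowMass w x) ∎

  rowProduct-vertices : ∀ {n k} (c : Vec (Fin r) n) i (x : Vec (Fin n) k) →
    (∀ l → lookup c (lookup x l) ≡ i) → rowProduct (Vec.map vertex c) i x ≡ L ^ k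
  rowProduct-vertices c i []      c≡i = refl
  rowProduct-vertices {k = suc k} c i (x ∷ t) c≡i = cong₂ _*_
    (trans (cong (λ ρ → ρ i) (lookup-map x vertex c))
      (trans (cong (L *_) (ind-true (lookup c x Fin.≟ i) (c≡i zero))) (ℕ.*-identityʳ L)))
    (rowProduct-vertices c i t (c≡i ∘ suc))

  rowMass-monochromatic : ∀ {n k} (c : Vec (Fin r) n) (x : Vec (Fin n) (suc k)) →
    Monochromatic (lookup c) x → L ^ suc k ≤ rowMass (Vec.map vertex c) x
  rowMass-monochromatic c x mono = ℕ.≤-trans
    (ℕ.≤-reflexive (sym (rowProduct-vertices c i x λ l → mono l zero)))
    (term≤∑ (λ i → rowProduct (Vec.map vertex c) i x) i)
    where
    i : Fin r
    i = lookup c (lookup x zero)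

-- A colouring with few monochromatic solutions

#solutions≡box : ∀ {k} (a : Vec ℤ k) n → #solutions a n ≡ box n k (hyperplane? a)
#solutions≡box {k} a n = trans (length-filter-tuples k n (solution? a))
  (∑ⱽ-cong n k λ x → cong (λ t → ind (t ℤ.≟ 0ℤ)) (lhs≡dot a x))

hyperplane?-onHyperplane : ∀ {k} (a : Vec ℤ k) → OnHyperplane a 0ℤ 1 (hyperplane? a)
hyperplane?-onHyperplane a .OnHyperplane.F≤M t = ind≤1 (dot a t ℤ.≟ 0ℤ)
hyperplane?-onHyperplane a .OnHyperplane.support t = ind≢0 (dot a t ℤ.≟ 0ℤ)

-- With d the number of coincidences of a tuple: either d = 0 and the tuple is counted by R,
-- or it is counted by d itself.
ind-cover : ∀ {A : Set} (A? : Dec A) s d P R → (A → s ≡ 1) → (A → P ≤ R) →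
            P * ind A? ≤ s * ind (d ℕ.≟ 0) * R + P * (s * d)
ind-cover (no _)  s d P R A⇒s≡1 A⇒P≤R = subst (_≤ s * ind (d ℕ.≟ 0) * R + P * (s * d)) (sym (ℕ.*-zeroʳ P)) z≤n
ind-cover (yes a) s d P R A⇒s≡1 A⇒P≤R with d ℕ.≟ 0
... | yes _ rewrite A⇒s≡1 a = ℕ.≤-trans (ℕ.≤-reflexive (ℕ.*-identityʳ P))
  (ℕ.≤-trans (A⇒P≤R a) (ℕ.≤-trans (ℕ.≤-reflexive (sym (ℕ.*-identityˡ R))) (ℕ.m≤m+n _ _)))
... | no d≢0 rewrite A⇒s≡1 a =
  ℕ.*-monoʳ-≤ P (ℕ.≤-trans (ℕ.n≢0⇒n>0 d≢0) (ℕ.≤-reflexive (sym (ℕ.*-identityˡ d))))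

module _ {r : ℕ} (L-1 : ℕ) where

  open Derandomisation {r} L-1

  -- Solutions with a repeated coordinate would spoil multiaffinity. They are left out of the
  -- functional that is derandomised, and the `dup` term pays for them in full.
  derandomised-colouring : ∀ {k} {a : Vec ℤ (suc k)} (weight : Fin r → ℤ → ℕ) →
    (∀ x → ∑[ i < r ] weight i x ≡ L) → ∀ n → ∃ λ (c : Colouring r n) →
    L ^ suc k * #monochromatic a c ≤ box n (suc k) (λ x → hyperplane? a x * weightedMass weight x)
                                     + L ^ suc k * ∑ⱽ n (suc k) (λ x → hyperplane? a (Vec.map ⟦_⟧ x) * dup x)
  derandomised-colouring {k′} {a} weight ∑-weight n = colouring , bound
    where
    k : ℕ
    k = suc k′
    ι : Vec (Fin n) k → Vec ℤ k
    ι = Vec.map ⟦_⟧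
    σ τ : Vec (Fin n) k → ℕ
    σ x = hyperplane? a (ι x)
    τ x = σ x * ind (dup x ℕ.≟ 0)
    w : Vec Row n
    w = Vec.tabulate (λ y i → weight i ⟦ y ⟧)
    w-balanced : Balanced w
    w-balanced = All.tabulate⁺ (λ y → ∑-weight ⟦ y ⟧)
    G : Vec Row n → ℕ
    G w = ∑ⱽ n k (λ x → τ x * rowMass w x)
    τ-injective : ∀ x → τ x ≢ 0 → dup x ≡ 0
    τ-injective x τ≢0 = ind≢0 (dup x ℕ.≟ 0) λ eq → τ≢0 (trans (cong (σ x *_) eq) (ℕ.*-zeroʳ (σ x)))
    derandomised : ∃ λ c → G (Vec.map vertex c) ≤ G w
    derandomised = derandomise G (∑ⱽ-rowMass-affine n k τ τ-injective) w w-balanced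
    colours : Vec (Fin r) n
    colours = proj₁ derandomised
    colouring : Colouring r n
    colouring = lookup colours
    rowProduct-w : ∀ {l} i (x : Vec (Fin n) l) → rowProduct w i x ≡ ∏ (weight i) (Vec.map ⟦_⟧ x)
    rowProduct-w i []      = refl
    rowProduct-w i (x ∷ t) = cong₂ _*_ (cong (λ ρ → ρ i) (lookup∘tabulate (λ y i → weight i ⟦ y ⟧) x)) (rowProduct-w i t)
    Gw≤ : G w ≤ ∑ⱽ n k (λ x → σ x * weightedMass weight (ι x))
    Gw≤ = ∑ⱽ-mono n k {λ x → τ x * rowMass w x} {λ x → σ x * weightedMass weight (ι x)} λ x → ℕ.*-mono-≤
      (ℕ.≤-trans (ℕ.*-monoʳ-≤ (σ x) (ind≤1 (dup x ℕ.≟ 0))) (ℕ.≤-reflexive (ℕ.*-identityʳ (σ x))))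
      (ℕ.≤-reflexive (sum-cong-≗ λ (i : Fin r) → rowProduct-w i x))
    mono? : ∀ x → Dec (Solution a x × Monochromatic colouring x)
    mono? x = solution? a x ×-dec monochromatic? colouring x
    mono≤ : ∀ x → L ^ k * ind (mono? x) ≤ τ x * rowMass (Vec.map vertex colours) x + L ^ k * (σ x * dup x)
    mono≤ x = ind-cover (mono? x) (σ x) (dup x) (L ^ k) (rowMass (Vec.map vertex colours) x)
      (λ (sol , _) → ind-true (dot a (ι x) ℤ.≟ 0ℤ) (trans (sym (lhs≡dot a x)) sol))
      (λ (_ , mono) → rowMass-monochromatic colours x mono)
    open ℕ.≤-Reasoning
    bound : L ^ k * #monochromatic a colouring
            ≤ ∑ⱽ n k (λ x → σ x * weightedMass weight (ι x)) + L ^ k * ∑ⱽ n k (λ x → σ x * dup x)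
    bound = begin
      L ^ k * #monochromatic a colouring
        ≡⟨ cong (L ^ k *_) (length-filter-tuples k n mono?) ⟩
      L ^ k * ∑ⱽ n k (λ x → ind (mono? x))
        ≡⟨ *-distribˡ-∑ⱽ n k (L ^ k) (λ x → ind (mono? x)) ⟩
      ∑ⱽ n k (λ x → L ^ k * ind (mono? x))
        ≤⟨ ∑ⱽ-mono n k {λ x → L ^ k * ind (mono? x)} {λ x → τ x * rowMass (Vec.map vertex colours) x + L ^ k * (σ x * dup x)} mono≤ ⟩
      ∑ⱽ n k (λ x → τ x * rowMass (Vec.map vertex colours) x + L ^ k * (σ x * dup x))
        ≡⟨ ∑ⱽ-distrib-+ n k (λ x → τ x * rowMass (Vec.map vertex colours) x) (λ x → L ^ k * (σ x * dup x)) ⟩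
      G (Vec.map vertex colours) + ∑ⱽ n k (λ x → L ^ k * (σ x * dup x))
        ≤⟨ ℕ.+-mono-≤ (ℕ.≤-trans (proj₂ derandomised) Gw≤)
             (ℕ.≤-reflexive (sym (*-distribˡ-∑ⱽ n k (L ^ k) (λ x → σ x * dup x)))) ⟩
      ∑ⱽ n k (λ x → σ x * weightedMass weight (ι x)) + L ^ k * ∑ⱽ n k (λ x → σ x * dup x) ∎

-- With k = 3 + j, L = `(3 + r) * suc B` and N solutions, division by Lᵏ gives at most ((3 +
-- r)^(1-k) - L^(-k)) N + O(n^(k-2)) monochromatic ones. The saving L^(-k) is independent of n.
good-colouring : ∀ {j} {a : Vec ℤ (3 + j)} → All (_≢ 0ℤ) a →
  ∀ e → 2 ≤ e → (ℤ.- (+ 2)) ℤ.^ (3 + j) ≡ ℤ.- (+ (2 * e)) → ∀ r →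
  ∃ λ B → ∃ λ C → ∀ n → ∃ λ (c : Colouring (3 + r) n) →
  ((3 + r) * suc B) ^ (3 + j) * #monochromatic a c + #solutions a n
  ≤ #solutions a n * ((3 + r) * suc B ^ (3 + j)) + n ^ (1 + j) * C
good-colouring {j} {a} a≢0 e 2≤e power r =
  1 + 2 * q , C₁ + L ^ k * C₂ , λ n → proj₁ (colouring n) , bound n
  where
  k q : ℕ
  k = 3 + j
  q = ∏ ∣_∣ a
  open Weights q r
  weighted : ∃ λ C → ∀ n → let N = box n k (hyperplane? a) in
    box n k (λ x → hyperplane? a x * mass x) + N ≤ N * ((3 + r) * B ^ k) + n ^ (1 + j) * C
  weighted = go a a≢0 (invertible-mod-1+∏ a)
    where
    go : ∀ (b : Vec ℤ k) → All (_≢ 0ℤ) b → All Invertible b → ∃ λ C → ∀ n → let N = box n k (hyperplane? b) in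
      box n k (λ x → hyperplane? b x * mass x) + N ≤ N * ((3 + r) * B ^ k) + n ^ (1 + j) * C
    go (_ ∷ _) b≢0 (b⁻¹ ∷ bs⁻¹) = ∑ⱽ-kernelAverage b≢0 (suc q) mass mass≤
      (mass-average b⁻¹ bs⁻¹ (∏-positive a≢0) e 2≤e power)
  duplicates : ∃ λ C → ∀ n → ∑ⱽ n k (λ x → hyperplane? a (Vec.map ⟦_⟧ x) * dup x) ≤ n ^ (1 + j) * C
  duplicates = proj₁ (∑ⱽ-dup-hyperplane j) , proj₂ (∑ⱽ-dup-hyperplane j) a≢0 (hyperplane?-onHyperplane a)
  C₁ C₂ : ℕ
  C₁ = proj₁ weighted
  C₂ = proj₁ duplicates
  colouring : ∀ n → ∃ λ (c : Colouring (3 + r) n) →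
    L ^ k * #monochromatic a c ≤ box n k (λ x → hyperplane? a x * mass x)
                               + L ^ k * ∑ⱽ n k (λ x → hyperplane? a (Vec.map ⟦_⟧ x) * dup x)
  -- The first argument is L - 1, one copy of `B` being split as 1 + (1 + 2q).
  colouring = derandomised-colouring (1 + 2 * q + (2 + r) * B) {2 + j} {a} weight ∑-weight
  module _ (n : ℕ) where
    open ℕ.≤-Reasoning
    #mono N Σmass : ℕ
    #mono = #monochromatic a (proj₁ (colouring n))
    N = #solutions a n
    Σmass = box n k (λ x → hyperplane? a x * mass x)
    eq₁ : ∀ x y z → x + y + z ≡ x + z + y
    eq₁ = ℕSolver.solve-∀
    eq₂ : ∀ x n c l d → x + n * c + l * (n * d) ≡ x + n * (c + l * d)
    eq₂ = ℕSolver.solve-∀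
    bound : L ^ k * #mono + N ≤ N * ((3 + r) * B ^ k) + n ^ (1 + j) * (C₁ + L ^ k * C₂)
    bound = begin
      L ^ k * #mono + N
        ≤⟨ ℕ.+-monoˡ-≤ N (ℕ.≤-trans (proj₂ (colouring n)) (ℕ.+-monoʳ-≤ Σmass (ℕ.*-monoʳ-≤ (L ^ k) (proj₂ duplicates n)))) ⟩
      Σmass + L ^ k * (n ^ (1 + j) * C₂) + N
        ≡⟨ eq₁ Σmass (L ^ k * (n ^ (1 + j) * C₂)) N ⟩
      Σmass + N + L ^ k * (n ^ (1 + j) * C₂)
        ≤⟨ ℕ.+-monoˡ-≤ (L ^ k * (n ^ (1 + j) * C₂))
             (subst (λ N → Σmass + N ≤ N * ((3 + r) * B ^ k) + n ^ (1 + j) * C₁) (sym (#solutions≡box a n)) (proj₂ weighted n)) ⟩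
      N * ((3 + r) * B ^ k) + n ^ (1 + j) * C₁ + L ^ k * (n ^ (1 + j) * C₂)
        ≡⟨ eq₂ (N * ((3 + r) * B ^ k)) (n ^ (1 + j)) C₁ (L ^ k) C₂ ⟩
      N * ((3 + r) * B ^ k) + n ^ (1 + j) * (C₁ + L ^ k * C₂) ∎

-- Lower bound for the number of solutions

⟦⟧-surjective : ∀ {n} m → m < n → ∃ λ (i : Fin n) → ⟦ i ⟧ ≡ + suc m
⟦⟧-surjective m m<n = fromℕ< m<n , cong (λ t → + suc t) (Fin.toℕ-fromℕ< m<n)

⟦⟧-between : ∀ {n} m → 1 ≤ m → m ≤ n → ∃ λ (i : Fin n) → ⟦ i ⟧ ≡ + m
⟦⟧-between (suc m) _ m<n = ⟦⟧-surjective m m<n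

-- As ⟦ z ⟧ lies between 1 and n₀, the number T ⟦ z ⟧ + c lies strictly between 0 and T (n₀ + 1).
⟦⟧-dilate : ∀ T {n₀} (z : Fin n₀) c → ∣ c ∣ < T → ∃ λ (i : Fin (T * suc n₀)) → ⟦ i ⟧ ≡ + T ℤ.* ⟦ z ⟧ ℤ.+ c
⟦⟧-dilate T {n₀} z (+ m) m<T =
  let i , eq = ⟦⟧-between (T * suc (toℕ z) + m) 1≤ ≤Tn in
  i , trans eq (cong (ℤ._+ (+ m)) (ℤ.pos-* T _))
  where
  open ℕ.≤-Reasoning
  1≤ : 1 ≤ T * suc (toℕ z) + m
  1≤ = ℕ.≤-trans (ℕ.*-mono-≤ {1} {T} {1} (ℕ.≤-trans (s≤s z≤n) m<T) (s≤s z≤n)) (ℕ.m≤m+n _ m)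
  ≤Tn : T * suc (toℕ z) + m ≤ T * suc n₀
  ≤Tn = begin
    T * suc (toℕ z) + m  ≤⟨ ℕ.+-mono-≤ (ℕ.*-monoʳ-≤ T (Fin.toℕ<n z)) (ℕ.<⇒≤ m<T) ⟩
    T * n₀ + T           ≡⟨ ℕ.+-comm (T * n₀) T ⟩
    T + T * n₀           ≡⟨ ℕ.*-suc T n₀ ⟨
    T * suc n₀           ∎
⟦⟧-dilate T {n₀} z -[1+ m ] m<T =
  let i , eq = ⟦⟧-between (T * suc (toℕ z) ℕ.∸ suc m) (ℕ.m<n⇒0<n∸m m<Tz) ≤Tn in
  i , trans eq (trans (sym (ℤ.⊖-≥ (ℕ.<⇒≤ m<Tz))) (cong (ℤ._+ -[1+ m ]) (ℤ.pos-* T _)))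
  where
  open ℕ.≤-Reasoning
  m<Tz : suc m < T * suc (toℕ z)
  m<Tz = ℕ.<-≤-trans m<T (ℕ.m≤m*n T (suc (toℕ z)))
  ≤Tn : T * suc (toℕ z) ℕ.∸ suc m ≤ T * suc n₀
  ≤Tn = ℕ.≤-trans (ℕ.m∸n≤m _ (suc m)) (ℕ.*-monoʳ-≤ T (ℕ.≤-trans (Fin.toℕ<n z) (ℕ.n≤1+n n₀)))

∑ⱽ-injection : ∀ {A : Set} {m n} (e : A → Fin m → Fin n) → (∀ z i j → e z i ≡ e z j → i ≡ j) →
  ∀ {d} (zs : Vec A d) F → ∑ⱽ m d (λ s → F (Vec.zipWith e zs s)) ≤ ∑ⱽ n d F
∑ⱽ-injection         e inj []       F = ℕ.≤-refl
∑ⱽ-injection {n = n} e inj {suc d} (z ∷ zs) F = ℕ.≤-trans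
  (∑-mono λ i → ∑ⱽ-injection e inj zs (λ t → F (e z i ∷ t)))
  (∑-injection (e z) (inj z) (λ i → ∑ⱽ n d (λ t → F (i ∷ t))))

∣dot-residues∣≤ : ∀ {S d} (a : Vec ℤ d) (s : Vec (Fin (suc S)) d) → ∣ dot a (residues s) ∣ ≤ ‖ a ‖ * S
∣dot-residues∣≤ []       []       = z≤n
∣dot-residues∣≤ {S} (a ∷ as) (s ∷ ss) = begin
  ∣ a ℤ.* + toℕ s ℤ.+ dot as (residues ss) ∣        ≤⟨ ℤ.∣i+j∣≤∣i∣+∣j∣ (a ℤ.* + toℕ s) _ ⟩
  ∣ a ℤ.* + toℕ s ∣ + ∣ dot as (residues ss) ∣      ≡⟨ cong (_+ ∣ dot as (residues ss) ∣) (ℤ.abs-* a (+ toℕ s)) ⟩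
  ∣ a ∣ * toℕ s + ∣ dot as (residues ss) ∣          ≤⟨ ℕ.+-mono-≤ (ℕ.*-monoʳ-≤ ∣ a ∣ (Fin.toℕ≤pred[n] s)) (∣dot-residues∣≤ as ss) ⟩
  ∣ a ∣ * S + ‖ as ‖ * S                            ≡⟨ ℕ.*-distribʳ-+ S ∣ a ∣ ‖ as ‖ ⟨
  (∣ a ∣ + ‖ as ‖) * S                              ∎
  where open ℕ.≤-Reasoning

-- Perturbing the large dilate T z of a solution z by vectors in the kernel of a keeps it inside the box.
many-solutions : ∀ {d n₀} {a : Vec ℤ (suc d)} → All (_≢ 0ℤ) a → (z : Vec (Fin n₀) (suc d)) → Solution a z →
  ∃ λ D → 1 ≤ D × (∀ S → suc S ^ d ≤ #solutions a (suc S * D))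
many-solutions {d} {n₀} {a₀ ∷ as} (a₀≢0 ∷ _) (z₀ ∷ zs) z-solution =
  W * suc n₀ , ℕ.*-mono-≤ {1} {W} {1} 1≤W (s≤s z≤n) , λ S → subst (λ n → suc S ^ d ≤ #solutions (a₀ ∷ as) n)
    (ℕ.*-assoc (suc S) W (suc n₀)) (ℕ.≤-trans (count S) (ℕ.≤-reflexive (sym (#solutions≡box (a₀ ∷ as) (suc S * W * suc n₀)))))
  where
  W : ℕ
  W = ‖ a₀ ∷ as ‖
  1≤∣a₀∣ : 1 ≤ ∣ a₀ ∣
  1≤∣a₀∣ = ℕ.n≢0⇒n>0 (a₀≢0 ∘ ℤ.∣i∣≡0⇒i≡0)
  1≤W : 1 ≤ W
  1≤W = ℕ.≤-trans 1≤∣a₀∣ (ℕ.m≤m+n ∣ a₀ ∣ ‖ as ‖)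
  module _ (S : ℕ) where
    T n : ℕ
    -- Kernel vectors with parameters at most `S` have entries of size at most `W * S`, which is
    -- less than `T`; the box size stays linear in `suc S`.
    T = suc S * W
    n = T * suc n₀
    W*S<T : W * S < T
    W*S<T = ℕ.≤-trans (ℕ.+-monoˡ-≤ (W * S) 1≤W) (ℕ.≤-reflexive (cong (_+_ W) (ℕ.*-comm W S)))
    a₀s<T : ∀ (s : Fin (suc S)) → ∣ a₀ ℤ.* + toℕ s ∣ < T
    a₀s<T s = ℕ.≤-<-trans (ℕ.≤-trans (ℕ.≤-reflexive (ℤ.abs-* a₀ (+ toℕ s)))
      (ℕ.*-mono-≤ (ℕ.m≤m+n ∣ a₀ ∣ ‖ as ‖) (Fin.toℕ≤pred[n] s))) W*S<T
    ass<T : ∀ (s : Vec (Fin (suc S)) d) → ∣ ℤ.- dot as (residues s) ∣ < T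
    ass<T s = ℕ.≤-<-trans (ℕ.≤-trans (ℕ.≤-reflexive (ℤ.∣-i∣≡∣i∣ (dot as (residues s))))
      (ℕ.≤-trans (∣dot-residues∣≤ as s) (ℕ.*-monoˡ-≤ S (ℕ.m≤n+m ‖ as ‖ ∣ a₀ ∣)))) W*S<T
    e : Fin n₀ → Fin (suc S) → Fin n
    e z s = proj₁ (⟦⟧-dilate T z (a₀ ℤ.* + toℕ s) (a₀s<T s))
    ⟦e⟧ : ∀ z s → ⟦ e z s ⟧ ≡ + T ℤ.* ⟦ z ⟧ ℤ.+ a₀ ℤ.* + toℕ s
    ⟦e⟧ z s = proj₂ (⟦⟧-dilate T z (a₀ ℤ.* + toℕ s) (a₀s<T s))
    e-injective : ∀ z s t → e z s ≡ e z t → s ≡ t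
    e-injective z s t eq = Fin.toℕ-injective (ℤ.+-injective (*-cancelˡ (+ toℕ s) (+ toℕ t) a₀≢0
      (trans (x+y≡z⇒y≡z-x Tz (trans (sym (⟦e⟧ z s)) (trans (cong ⟦_⟧ eq) (⟦e⟧ z t)))) (sym (x+y≡z⇒y≡z-x Tz refl)))))
      where
      Tz : ℤ
      Tz = + T ℤ.* ⟦ z ⟧
    head-solution : Vec (Fin (suc S)) d → Fin n
    head-solution s = proj₁ (⟦⟧-dilate T z₀ (ℤ.- dot as (residues s)) (ass<T s))
    dot-e : ∀ {d} (bs : Vec ℤ d) zs s →
      dot bs (Vec.map ⟦_⟧ (Vec.zipWith e zs s)) ≡ + T ℤ.* dot bs (Vec.map ⟦_⟧ zs) ℤ.+ a₀ ℤ.* dot bs (residues s)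
    dot-e []       []       []       = eq (+ T) a₀
      where
      eq : ∀ T a → 0ℤ ≡ T ℤ.* 0ℤ ℤ.+ a ℤ.* 0ℤ
      eq = ℤSolver.solve-∀
    dot-e (b ∷ bs) (z ∷ zs) (s ∷ ss) = trans
      (cong₂ (λ x y → b ℤ.* x ℤ.+ y) (⟦e⟧ z s) (dot-e bs zs ss))
      (eq (+ T) a₀ b ⟦ z ⟧ (+ toℕ s) (dot bs (Vec.map ⟦_⟧ zs)) (dot bs (residues ss)))
      where
      eq : ∀ T a b z s zs ss → b ℤ.* (T ℤ.* z ℤ.+ a ℤ.* s) ℤ.+ (T ℤ.* zs ℤ.+ a ℤ.* ss)
           ≡ T ℤ.* (b ℤ.* z ℤ.+ zs) ℤ.+ a ℤ.* (b ℤ.* s ℤ.+ ss)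
      eq = ℤSolver.solve-∀
    solves : ∀ s → dot (a₀ ∷ as) (Vec.map ⟦_⟧ (head-solution s ∷ Vec.zipWith e zs s)) ≡ 0ℤ
    solves s = trans
      (cong₂ (λ x y → a₀ ℤ.* x ℤ.+ y) (proj₂ (⟦⟧-dilate T z₀ (ℤ.- dot as (residues s)) (ass<T s))) (dot-e as zs s))
      (trans (eq (+ T) a₀ ⟦ z₀ ⟧ (dot as (Vec.map ⟦_⟧ zs)) (dot as (residues s)))
        (trans (cong (+ T ℤ.*_) (trans (sym (lhs≡dot (a₀ ∷ as) (z₀ ∷ zs))) z-solution)) (ℤ.*-zeroʳ (+ T))))
      where
      eq : ∀ T a z zs ss → a ℤ.* (T ℤ.* z ℤ.+ ℤ.- ss) ℤ.+ (T ℤ.* zs ℤ.+ a ℤ.* ss) ≡ T ℤ.* (a ℤ.* z ℤ.+ zs)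
      eq = ℤSolver.solve-∀
    σ : Vec (Fin n) (suc d) → ℕ
    σ x = hyperplane? (a₀ ∷ as) (Vec.map ⟦_⟧ x)
    open ℕ.≤-Reasoning
    -- Distinct parameters give distinct tails because a₀ is nonzero, so it suffices that each tail
    -- has some head completing it to a solution.
    count : suc S ^ d ≤ ∑ⱽ n (suc d) σ
    count = begin
      suc S ^ d
        ≡⟨ trans (sym (ℕ.*-identityʳ _)) (sym (∑ⱽ-const (suc S) d 1)) ⟩
      ∑ⱽ (suc S) d (λ _ → 1)
        ≤⟨ ∑ⱽ-mono (suc S) d {λ _ → 1} {λ s → ∑[ x < n ] σ (x ∷ Vec.zipWith e zs s)} (λ s → ℕ.≤-trans
             (ℕ.≤-reflexive (sym (ind-true (dot (a₀ ∷ as) (Vec.map ⟦_⟧ (head-solution s ∷ Vec.zipWith e zs s)) ℤ.≟ 0ℤ) (solves s))))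
             (term≤∑ (λ x → σ (x ∷ Vec.zipWith e zs s)) (head-solution s))) ⟩
      ∑ⱽ (suc S) d (λ s → ∑[ x < n ] σ (x ∷ Vec.zipWith e zs s))
        ≡⟨ ∑-∑ⱽ-comm n (suc S) d (λ x s → σ (x ∷ Vec.zipWith e zs s)) ⟨
      ∑[ x < n ] ∑ⱽ (suc S) d (λ s → σ (x ∷ Vec.zipWith e zs s))
        ≤⟨ ∑-mono (λ (x : Fin n) → ∑ⱽ-injection e e-injective zs (λ t → σ (x ∷ t))) ⟩
      ∑ⱽ n (suc d) σ ∎

-- The contradiction with commonness

ratio≃ : ∀ p q → toℚᵘ (ratio p (suc q)) ℚᵘ.≃ mkℚᵘ (+ p) q
ratio≃ p q = ℚ.toℚᵘ-fromℚᵘ (mkℚᵘ (+ p) q)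

ratio-positive : ∀ q → 1 ≤ q → 0ℚ ℚ.< ratio 1 q
ratio-positive (suc q) _ = ℚ.toℚᵘ-cancel-< (ℚᵘ.<-respʳ-≃ (ℚᵘ.≃-sym (ratio≃ 1 q)) (ℚᵘ.*<* (ℤ.+<+ (s≤s z≤n))))

ratio-≤⇒ : ∀ r R E m N → 1 ≤ R → 1 ≤ E → 1 ≤ N → ratio r R ℚ.- ratio 1 E ℚ.≤ ratio m N →
           r * E * N ≤ m * (R * E) + R * N
ratio-≤⇒ r (suc R) (suc E) m (suc N) _ _ _ h = ℤ.drop‿+≤+ (subst₂ ℤ._≤_ lhs≡ rhs≡ (ℤ.+-monoˡ-≤ (+ (suc R * suc N)) integer≤))
  where
  unnormalised≤ : mkℚᵘ (+ r) R ℚᵘ.+ ℚᵘ.- mkℚᵘ 1ℤ E ℚᵘ.≤ mkℚᵘ (+ m) N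
  unnormalised≤ = ℚᵘ.≤-respʳ-≃ (ratio≃ m N) (ℚᵘ.≤-respˡ-≃
    (ℚᵘ.≃-trans (ℚ.toℚᵘ-homo-+ (ratio r (suc R)) (ℚ.- ratio 1 (suc E)))
      (ℚᵘ.+-cong (ratio≃ r R) (ℚᵘ.≃-trans (ℚ.toℚᵘ-homo‿- (ratio 1 (suc E))) (ℚᵘ.-‿cong (ratio≃ 1 E)))))
    (ℚ.toℚᵘ-mono-≤ h))
  integer≤ : (+ r ℤ.* + suc E ℤ.+ ℤ.- 1ℤ ℤ.* + suc R) ℤ.* + suc N ℤ.≤ + m ℤ.* + (suc R * suc E)
  integer≤ = ℚᵘ.drop-*≤* unnormalised≤
  eq : ∀ r e R n → (r ℤ.* e ℤ.+ ℤ.- 1ℤ ℤ.* R) ℤ.* n ℤ.+ R ℤ.* n ≡ r ℤ.* e ℤ.* n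
  eq = ℤSolver.solve-∀
  lhs≡ : (+ r ℤ.* + suc E ℤ.+ ℤ.- 1ℤ ℤ.* + suc R) ℤ.* + suc N ℤ.+ + (suc R * suc N) ≡ + (r * suc E * suc N)
  lhs≡ = trans (cong (ℤ._+_ ((+ r ℤ.* + suc E ℤ.+ ℤ.- 1ℤ ℤ.* + suc R) ℤ.* + suc N)) (ℤ.pos-* (suc R) (suc N)))
    (trans (eq (+ r) (+ suc E) (+ suc R) (+ suc N))
      (sym (trans (ℤ.pos-* (r * suc E) (suc N)) (cong (ℤ._* + suc N) (ℤ.pos-* r (suc E))))))
  rhs≡ : + m ℤ.* + (suc R * suc E) ℤ.+ + (suc R * suc N) ≡ + (m * (suc R * suc E) + suc R * suc N)
  rhs≡ = cong (ℤ._+ + (suc R * suc N)) (sym (ℤ.pos-* m (suc R * suc E)))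

1≤^ : ∀ m k → 1 ≤ m → 1 ≤ m ^ k
1≤^ m k 1≤m = ℕ.≤-trans (ℕ.≤-reflexive (sym (ℕ.^-zeroˡ k))) (ℕ.^-monoˡ-≤ k 1≤m)

^-distribʳ-* : ∀ k m n → (m * n) ^ k ≡ m ^ k * n ^ k
^-distribʳ-* zero    m n = refl
^-distribʳ-* (suc k) m n = trans (cong (m * n *_) (^-distribʳ-* k m n)) (eq m n (m ^ k) (n ^ k))
  where
  eq : ∀ m n x y → m * n * (x * y) ≡ m * x * (n * y)
  eq = ℕSolver.solve-∀

uncommon-of-power : ∀ {j} {a : Vec ℤ (3 + j)} → All (_≢ 0ℤ) a →
  ∀ e → 2 ≤ e → (ℤ.- (+ 2)) ℤ.^ (3 + j) ≡ ℤ.- (+ (2 * e)) → ∀ r → Uncommon (3 + r) a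
uncommon-of-power {j} {a} a≢0 e 2≤e power r common = ℕ.<⇒≱ ℕ.≤-refl S≤
  where
  k r̂ : ℕ
  k = 3 + j
  r̂ = 3 + r
  good : ∃ λ B → ∃ λ C → ∀ n → ∃ λ (c : Colouring r̂ n) →
    (r̂ * suc B) ^ k * #monochromatic a c + #solutions a n ≤ #solutions a n * (r̂ * suc B ^ k) + n ^ (1 + j) * C
  good = good-colouring a≢0 e 2≤e power r
  B C b R E : ℕ
  B = suc (proj₁ good)
  C = proj₁ (proj₂ good)
  b = B ^ k
  R = r̂ ^ k
  -- `good` saves 1 / (R b) on the proportion. The tolerance 1 / E is half of this, which leaves the
  -- other half for the error term to absorb.
  E = 2 * (R * b)
  c : ∀ n → Colouring r̂ n
  c n = proj₁ (proj₂ (proj₂ good) n)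
  c-good : ∀ n → R * b * #monochromatic a (c n) + #solutions a n ≤ #solutions a n * (r̂ * b) + n ^ (1 + j) * C
  c-good n = subst (λ L^k → L^k * #monochromatic a (c n) + #solutions a n ≤ #solutions a n * (r̂ * b) + n ^ (1 + j) * C)
    (^-distribʳ-* k r̂ B) (proj₂ (proj₂ (proj₂ good) n))
  1≤b : 1 ≤ b
  1≤b = 1≤^ B k (s≤s z≤n)
  1≤R : 1 ≤ R
  1≤R = 1≤^ r̂ k (s≤s z≤n)
  1≤E : 1 ≤ E
  1≤E = ℕ.*-mono-≤ {1} {2} {1} (s≤s z≤n) (ℕ.*-mono-≤ 1≤R 1≤b)
  instance
    R-nonZero : NonZero R
    R-nonZero = ℕ.>-nonZero 1≤R
  threshold : ∃ λ N → ∀ n → n ≥ N → (c : Colouring r̂ n) → ratio r̂ R ℚ.- ratio 1 E ℚ.≤ proportion a c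
  threshold = common (ratio 1 E) (ratio-positive E 1≤E)
  n₀ : ℕ
  n₀ = proj₁ threshold
  open ℕ.≤-Reasoning

  -- Without solutions the proportion is 0, so commonness would give r̂ / R ≤ 1 / E, whereas E is at
  -- least 2 R. This disposes of coefficients that all have the same sign.
  #solutions≢0 : #solutions a n₀ ≢ 0
  #solutions≢0 none = ℕ.<⇒≱ (begin-strict
    R              <⟨ ℕ.m<m+n R 1≤R ⟩
    R + R          ≤⟨ ℕ.≤-trans (ℕ.≤-reflexive (eq₁ R)) (ℕ.*-monoʳ-≤ (2 * R) 1≤b) ⟩
    2 * R * b      ≡⟨ ℕ.*-assoc 2 R b ⟩
    E              ≤⟨ ℕ.m≤n*m E r̂ ⟩
    r̂ * E          ∎)
    (subst₂ _≤_ (ℕ.*-identityʳ (r̂ * E)) (ℕ.*-identityʳ R)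
      -- The default value of `ratio` at denominator 0 equals 0 / 1, hence these arguments.
      (ratio-≤⇒ r̂ R E 0 1 1≤R 1≤E ℕ.≤-refl
        (subst (λ N → ratio r̂ R ℚ.- ratio 1 E ℚ.≤ ratio (#monochromatic a (c n₀)) N) none (proj₂ threshold n₀ ℕ.≤-refl (c n₀)))))
    where
    eq₁ : ∀ R → R + R ≡ 2 * R * 1
    eq₁ = ℕSolver.solve-∀

  -- Commonness gives r̂ b N ≤ R b M + N / 2, and the good colouring gives R b M + N ≤ r̂ b N + D;
  -- together they leave N ≤ 2 D.
  #solutions≤ : ∀ n → n ≥ n₀ → 1 ≤ #solutions a n → #solutions a n ≤ 2 * (n ^ (1 + j) * C)
  #solutions≤ n n≥n₀ 1≤N = ℕ.+-cancelˡ-≤ (2 * (R * b * M) + N) N (2 * D) (begin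
    2 * (R * b * M) + N + N              ≡⟨ eq₁ (R * b * M) N ⟩
    2 * (R * b * M + N)                  ≤⟨ ℕ.*-monoʳ-≤ 2 (c-good n) ⟩
    2 * (N * (r̂ * b) + D)                ≡⟨ eq₂ N (r̂ * b) D ⟩
    2 * (r̂ * b) * N + 2 * D              ≤⟨ ℕ.+-monoˡ-≤ (2 * D) (ℕ.*-cancelˡ-≤ R dense) ⟩
    2 * (R * b * M) + N + 2 * D          ∎)
    where
    M N D : ℕ
    M = #monochromatic a (c n)
    N = #solutions a n
    D = n ^ (1 + j) * C
    eq₁ : ∀ x N → 2 * x + N + N ≡ 2 * (x + N)
    eq₁ = ℕSolver.solve-∀
    eq₂ : ∀ N x D → 2 * (N * x + D) ≡ 2 * x * N + 2 * D
    eq₂ = ℕSolver.solve-∀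
    eq₃ : ∀ R r b N → R * (2 * (r * b) * N) ≡ r * (2 * (R * b)) * N
    eq₃ = ℕSolver.solve-∀
    eq₄ : ∀ R b M N → M * (R * (2 * (R * b))) + R * N ≡ R * (2 * (R * b * M) + N)
    eq₄ = ℕSolver.solve-∀
    dense : R * (2 * (r̂ * b) * N) ≤ R * (2 * (R * b * M) + N)
    dense = subst₂ _≤_ (sym (eq₃ R r̂ b N)) (eq₄ R b M N)
      (ratio-≤⇒ r̂ R E M N 1≤R 1≤E 1≤N (proj₂ threshold n n≥n₀ (c n)))

  solution : ∃ λ (z : Vec (Fin n₀) k) → ind (solution? a z) ≢ 0
  solution = ∑ⱽ≢0⇒∃ n₀ k (λ x → ind (solution? a x)) (λ eq → #solutions≢0 (trans (length-filter-tuples k n₀ (solution? a)) eq))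
  many : ∃ λ D → 1 ≤ D × (∀ S → suc S ^ (2 + j) ≤ #solutions a (suc S * D))
  many = many-solutions a≢0 (proj₁ solution) (ind≢0 (solution? a (proj₁ solution)) (proj₂ solution))
  D K S : ℕ
  D = proj₁ many
  K = 2 * (D ^ (1 + j) * C)
  -- Large enough that `suc S` exceeds `K` and `suc S * D` reaches the threshold `n₀`.
  S = K + n₀
  S≤ : suc S ≤ S
  S≤ = ℕ.≤-trans (ℕ.*-cancelˡ-≤ (suc S ^ (1 + j)) {{ℕ.m^n≢0 (suc S) (1 + j)}} (begin
    suc S ^ (1 + j) * suc S              ≡⟨ ℕ.*-comm _ (suc S) ⟩
    suc S ^ (2 + j)                      ≤⟨ proj₂ (proj₂ many) S ⟩
    #solutions a (suc S * D)             ≤⟨ #solutions≤ (suc S * D) large (ℕ.≤-trans (1≤^ (suc S) (2 + j) (s≤s z≤n)) (proj₂ (proj₂ many) S)) ⟩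
    2 * ((suc S * D) ^ (1 + j) * C)      ≡⟨ cong (λ t → 2 * (t * C)) (^-distribʳ-* (1 + j) (suc S) D) ⟩
    2 * (suc S ^ (1 + j) * D ^ (1 + j) * C) ≡⟨ eq (suc S ^ (1 + j)) (D ^ (1 + j)) C ⟩
    suc S ^ (1 + j) * K                  ∎)) (ℕ.m≤m+n K n₀)
    where
    eq : ∀ x y C → 2 * (x * y * C) ≡ x * (2 * (y * C))
    eq = ℕSolver.solve-∀
    large : n₀ ≤ suc S * D
    large = ℕ.≤-trans (ℕ.≤-trans (ℕ.m≤n+m n₀ (suc K)) (ℕ.≤-reflexive (sym (ℕ.*-identityʳ (suc S)))))
                      (ℕ.*-monoʳ-≤ (suc S) (proj₁ (proj₂ many)))

-2^odd : ∀ i → (ℤ.- (+ 2)) ℤ.^ (3 + 2 * i) ≡ ℤ.- (+ (2 * 4 ^ suc i))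
-2^odd zero = refl
-2^odd (suc i) = begin
  (ℤ.- (+ 2)) ℤ.^ (3 + 2 * suc i)
    ≡⟨ cong (λ l → (ℤ.- (+ 2)) ℤ.^ (3 + l)) (ℕ.*-suc 2 i) ⟩
  ℤ.- (+ 2) ℤ.* (ℤ.- (+ 2) ℤ.* (ℤ.- (+ 2)) ℤ.^ (3 + 2 * i))
    ≡⟨ cong (λ t → ℤ.- (+ 2) ℤ.* (ℤ.- (+ 2) ℤ.* t)) (-2^odd i) ⟩
  ℤ.- (+ 2) ℤ.* (ℤ.- (+ 2) ℤ.* ℤ.- (+ (2 * 4 ^ suc i)))
    ≡⟨ eq (+ (2 * 4 ^ suc i)) ⟩
  ℤ.- (+ 4 ℤ.* + (2 * 4 ^ suc i))
    ≡⟨ cong ℤ.-_ (sym (ℤ.pos-* 4 (2 * 4 ^ suc i))) ⟩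
  ℤ.- (+ (4 * (2 * 4 ^ suc i)))
    ≡⟨ cong (λ t → ℤ.- (+ t)) (eq′ (4 ^ suc i)) ⟩
  ℤ.- (+ (2 * 4 ^ suc (suc i))) ∎
  where
  open ≡-Reasoning
  eq : ∀ x → ℤ.- (+ 2) ℤ.* (ℤ.- (+ 2) ℤ.* ℤ.- x) ≡ ℤ.- (+ 4 ℤ.* x)
  eq = ℤSolver.solve-∀
  eq′ : ∀ x → 4 * (2 * x) ≡ 2 * (4 * x)
  eq′ = ℕSolver.solve-∀

uncommon-of-odd : ∀ {k} i → k ≡ 3 + 2 * i → (a : Vec ℤ k) → All (_≢ 0ℤ) a → ∀ r → Uncommon (3 + r) a
uncommon-of-odd i refl a a≢0 = uncommon-of-power a≢0 (4 ^ suc i) 2≤4^ (-2^odd i)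
  where
  2≤4^ : 2 ≤ 4 ^ suc i
  2≤4^ = ℕ.*-mono-≤ {2} {4} {1} (s≤s (s≤s z≤n)) (1≤^ 4 i (s≤s z≤n))

corollary1p2 : ∀ (m : ℕ) → m ≥ 1 → (a : Vec ℤ (2 * m + 1)) → All (λ aᵢ → aᵢ ≢ 0ℤ) a → ∀ (r : ℕ) → r ≥ 3 → Uncommon r a
corollary1p2 (suc i) _ a a≢0 (suc (suc (suc r))) (s≤s (s≤s (s≤s _))) = uncommon-of-odd i (eq i) a a≢0 r
  where
  eq : ∀ i → 2 * suc i + 1 ≡ 3 + 2 * i
  eq = ℕSolver.solve-∀
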